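{- Let $\kappa<\lambda$ be cardinals with $\lambda$ regular, and suppose $\square(\lambda,<\kappa)$ holds. Then $\mathrm{Refl}(<\kappa,S)$ fails for every stationary $S\subseteq S^\lambda_{\geq\kappa}$.
   Context: $S^\lambda_{\geq\kappa}=\{\alpha<\lambda\mid\mathrm{cf}(\alpha)\geq\kappa\}$. For a set of ordinals $A$, $\mathrm{acc}(A)$ is the set of $\beta<\sup\{\alpha+1\mid\alpha\in A\}$ with $\beta=\sup(A\cap\beta)$. A coherent sequence of length $\lambda$ and width $<\eta$ is $\mathcal{C}=\langle\mathcal{C}_\alpha\mid\alpha<\lambda\rangle$ where each $\mathcal{C}_\alpha$ is a nonempty set of fewer than $\eta$ closed unbounded subsets of $\alpha$ (for successor $\alpha=\beta+1$, $\mathcal{C}_\alpha=\{\{\beta\}\}$), such that for all $\beta<\lambda$, $C\in\mathcal{C}_\beta$ and $\alpha\in\mathrm{acc}(C)$, $C\cap\alpha\in\mathcal{C}_\alpha$. A thread is a club $D\subseteq\lambda$ with $D\cap\alpha\in\mathcal{C}_\alpha$ for all $\alpha\in\mathrm{acc}(D)$. $\square(\lambda,<\eta)$ asserts the existence of a coherent sequence of length $\lambda$ and width $<\eta$ with no thread. A stationary $S\subseteq\lambda$ reflects at $\alpha<\lambda$ if $\mathrm{cf}(\alpha)>\omega$ and $S\cap\alpha$ is stationary in $\alpha$; a collection of stationary sets reflects simultaneously if there is one $\alpha<\lambda$ at which all reflect. $\mathrm{Refl}(<\kappa,S)$ says every collection of fewer than $\kappa$ stationary subsets of $S$ reflects simultaneously.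 -}

module Defs where

open import Level using (Level; _⊔_) renaming (suc to lsuc)
open import Data.Product using (Σ; ∃; ∃-syntax; _×_; proj₁)
open import Data.Sum using (_⊎_)
open import Function.Bundles using (Bijection; _⇔_)
open import Induction.WellFounded using (WellFounded)
open import Relation.Binary.Bundles using (Setoid)
open import Relation.Binary.Core using (Rel)
open import Relation.Binary.Definitions using (_Respects_)
open import Relation.Binary.Structures using (IsStrictTotalOrder)
open import Relation.Binary.PropositionalEquality using (_≡_; setoid)
open import Relation.Nullary using (¬_)
open import Relation.Unary using (Pred; _∈_; _⊆_; _≐_; _∩_; ｛_｝; U; Satisfiable)
open import Relation.Unary.Relation.Binary.Equality using (≐-setoid)
import Relation.Binary.Construct.On as On

-- An ordinal λ, presented as a well-ordered type whose elements are the
-- ordinals α < λ.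
record Ordinal ℓ : Set (lsuc ℓ) where
  field
    Carrier            : Set ℓ
    _<_                : Rel Carrier ℓ
    isStrictTotalOrder : IsStrictTotalOrder _≡_ _<_
    wellFounded        : WellFounded _<_

module Below {ℓ : Level} (Λ : Ordinal ℓ) where

  open Ordinal Λ public using (_<_) renaming (Carrier to Ord)

  infix 4 _≤_

  _≤_ : Rel Ord ℓ
  α ≤ β = α < β ⊎ α ≡ β

  -- Ordinals δ ≤ λ occur below as initial segments I of Ord:
  -- ↓ α stands for α < λ, and U stands for λ itself.
  ↓ : Ord → Pred Ord ℓ
  ↓ α = λ ξ → ξ < α

  Subset : Set (lsuc ℓ)
  Subset = Pred Ord ℓ

  -- Subsets are compared extensionally (_≐_); a set of subsets is a
  -- predicate on Subset that is required, where it is used, to respect _≐_.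
  Collection : Set (lsuc (lsuc ℓ))
  Collection = Pred Subset (lsuc ℓ)

  IsSuccessorOf : Ord → Ord → Set ℓ
  IsSuccessorOf β α = β < α × (∀ γ → γ < α → γ ≤ β)

  IsLimit : ∀ {i} → Pred Ord i → Set (ℓ ⊔ i)
  IsLimit I = ∃⟨ I ⟩ × (∀ β → β ∈ I → ∃[ γ ] (γ ∈ I × β < γ))

  IsOmega : Ord → Set ℓ
  IsOmega w = IsLimit (↓ w) × (∀ v → v < w → ¬ IsLimit (↓ v))

  ElementsOf : ∀ {i} → Pred Ord i → Setoid (ℓ ⊔ i) ℓ
  ElementsOf I = On.setoid (setoid Ord) (proj₁ {B = I})

  MembersOf : Collection → Setoid (lsuc ℓ) ℓ
  MembersOf 𝒳 = On.setoid (≐-setoid Ord ℓ) (proj₁ {B = 𝒳})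

  IsCardinal : ∀ {i} → Pred Ord i → Set (ℓ ⊔ i)
  IsCardinal I = ∀ β → β ∈ I → ¬ Bijection (ElementsOf (↓ β)) (ElementsOf I)

  IsInfiniteCardinal : Ord → Set ℓ
  IsInfiniteCardinal κ = IsCardinal (↓ κ) × ∃[ w ] (IsOmega w × w ≤ κ)

  FewerThan : Ord → Collection → Set (lsuc ℓ)
  FewerThan κ 𝒳 = ∃[ β ] (β < κ × Bijection (ElementsOf (↓ β)) (MembersOf 𝒳))

  -- Some map from β into I has range cofinal in I. The map is given as a
  -- total function on Ord of which only the restriction to β matters.
  HasCofinalMap : ∀ {i} → Ord → Pred Ord i → Set (ℓ ⊔ i)
  HasCofinalMap β I =
    Σ (Ord → Ord) λ f →
      (∀ ξ → ξ < β → f ξ ∈ I) ×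
      (∀ γ → γ ∈ I → ∃[ ξ ] (ξ < β × γ ≤ f ξ))

  -- cf(α) = β. Since cf(α) ≤ α < λ, the value is always found in Ord.
  Cf : Ord → Ord → Set ℓ
  Cf α β = HasCofinalMap β (↓ α) × (∀ γ → γ < β → ¬ HasCofinalMap γ (↓ α))

  Cf≥ : Ord → Pred Ord ℓ
  Cf≥ κ α = ∃[ β ] (Cf α β × κ ≤ β)

  Cf>ω : Pred Ord ℓ
  Cf>ω α = ∃[ β ] (Cf α β × ∃[ w ] (IsOmega w × w < β))

  -- λ is an infinite cardinal with cf(λ) = λ.
  LengthIsRegular : Set ℓ
  LengthIsRegular =
    IsLimit (U {A = Ord}) × IsCardinal (U {A = Ord}) × (∀ β → ¬ HasCofinalMap β U)

  IsSup : Subset → Ord → Set ℓ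
  IsSup A σ =
    (∀ α → α ∈ A → α ≤ σ) ×
    (∀ τ → (∀ α → α ∈ A → α ≤ τ) → σ ≤ τ)

  -- β < sup {α + 1 ∣ α ∈ A} says that β < α + 1, i.e. β ≤ α, for some α ∈ A;
  -- the supremum itself may be λ, which is not an element of Ord.
  -- As sup ∅ = 0, the ordinal 0 belongs to acc A for every nonempty A.
  acc : Subset → Pred Ord ℓ
  acc A β = (∃[ α ] (α ∈ A × β ≤ α)) × IsSup (A ∩ ↓ β) β

  -- With _≤_ instead of _<_ in this definition, {β} is unbounded in β + 1.
  IsUnboundedIn : ∀ {i} → Pred Ord i → Subset → Set (ℓ ⊔ i)
  IsUnboundedIn I C = ∀ β → β ∈ I → ∃[ γ ] (γ ∈ C × β ≤ γ)

  -- Nonemptiness of C ∩ β excludes β = 0 = sup ∅.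
  IsClosedIn : ∀ {i} → Pred Ord i → Subset → Set (ℓ ⊔ i)
  IsClosedIn I C = ∀ β → β ∈ I → ∃⟨ C ∩ ↓ β ⟩ → IsSup (C ∩ ↓ β) β → β ∈ C

  IsClubIn : ∀ {i} → Pred Ord i → Subset → Set (ℓ ⊔ i)
  IsClubIn I C = C ⊆ I × IsClosedIn I C × IsUnboundedIn I C

  IsStationaryIn : ∀ {i} → Pred Ord i → Subset → Set (lsuc ℓ ⊔ i)
  IsStationaryIn I S = S ⊆ I × (∀ C → IsClubIn I C → ∃⟨ S ∩ C ⟩)

  IsStationary : Subset → Set (lsuc ℓ)
  IsStationary = IsStationaryIn U

  record IsCoherentSequence (η : Ord) (𝒞 : Ord → Collection) : Set (lsuc ℓ) where
    field
      extensional : ∀ α → 𝒞 α Respects _≐_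
      nonempty    : ∀ α → ∃⟨ 𝒞 α ⟩
      width       : ∀ α → FewerThan η (𝒞 α)
      clubs       : ∀ α C → C ∈ 𝒞 α → IsClubIn (↓ α) C
      successor   : ∀ α β → IsSuccessorOf β α → ∀ C → C ∈ 𝒞 α ⇔ C ≐ ｛ β ｝
      coherent    : ∀ β C → C ∈ 𝒞 β → ∀ α → α ∈ acc C → (C ∩ ↓ α) ∈ 𝒞 α

  IsThread : (Ord → Collection) → Subset → Set (lsuc ℓ)
  IsThread 𝒞 D = IsClubIn U D × (∀ α → α ∈ acc D → (D ∩ ↓ α) ∈ 𝒞 α)

  -- □(λ, <η)
  Square : Ord → Set (lsuc (lsuc ℓ))
  Square η = ∃[ 𝒞 ] (IsCoherentSequence η 𝒞 × ¬ ∃ (IsThread 𝒞))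

  ReflectsAt : Subset → Ord → Set (lsuc ℓ)
  ReflectsAt S α = Cf>ω α × IsStationaryIn (↓ α) (S ∩ ↓ α)

  -- Refl(<κ, S)
  Refl : Ord → Subset → Set (lsuc (lsuc ℓ))
  Refl κ S =
    (𝒯 : Collection) → 𝒯 Respects _≐_ → FewerThan κ 𝒯 →
    (∀ T → T ∈ 𝒯 → T ⊆ S × IsStationary T) →
    ∃[ α ] (∀ T → T ∈ 𝒯 → ReflectsAt T α)

{-# OPTIONS --safe #-}

-- By Fodor's lemma, shrink S so that all 𝒞 β (β ∈ S) have the same size μ < κ
-- and their members are told apart by their traces on one fixed γ: this uses
-- cf β ≥ κ. If all sets of a family reflect at α and C ∈ 𝒞 α, then acc C meets
-- each of them, and by coherence C ∩ γ is a trace at every point of acc C ∩ S.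
--
-- For a trace z, let x β be the member of 𝒞 β with trace z, where there is one.
-- Unless some ξ belongs to x β for stationarily many β and is missing from x β
-- for stationarily many β, the sets x β cohere on a stationary set and their
-- union is a thread. So every z has two stationary sets whose simultaneous
-- reflection at α excludes C ∩ γ = z for C ∈ 𝒞 α.
--
-- It remains to find fewer than κ stationary sets whose simultaneous reflection
-- confines C ∩ γ to fewer than κ traces. Rank a trace by the first β ∈ S at
-- which it occurs, and confine the ranks below ζ by induction on ζ. If ζ has
-- small cofinality, collect the families for a cofinal set. Otherwise the ranks
-- below ζ occurring at β are bounded below ζ, and by the same bound η for
-- stationarily many β; add this stationary set to the family for η. Finally all
-- ranks are confined in the same way by pressing down.
module Submission where

open import Defs
open import Axiom.ExcludedMiddle using (ExcludedMiddle)
open import Relation.Nullary using (¬_)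
open import Relation.Unary using (_⊆_)

open import Level using (Level; _⊔_; Lift; lift) renaming (suc to lsuc)
open import Data.Bool.Properties using (T-irrelevant)
open import Data.Empty using (⊥; ⊥-elim)
open import Data.Fin using (Fin; toℕ; fromℕ<)
open import Data.Fin.Properties using (toℕ<n; toℕ-injective; toℕ-fromℕ<)
open import Data.List using (List; []; _∷_; _++_; map; concat; length; tabulate)
import Data.List.Membership.Propositional as List
open import Data.List.Membership.Propositional.Properties using (∈-map⁺; ∈-++⁺ˡ; ∈-++⁺ʳ; ∈-concat⁺′; ∈-tabulate⁺)
open import Data.List.Membership.Setoid.Properties using (index-injective)
open import Data.List.Relation.Unary.Any as Any using (here)
open import Data.Nat using (ℕ; zero; suc)
import Data.Nat as ℕ
import Data.Nat.Properties as ℕ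
open import Data.Product using (Σ; ∃; ∃-syntax; _×_; _,_; proj₁; proj₂)
open import Data.Product.Relation.Binary.Lex.Strict using (×-Lex; ×-wellFounded; ×-compare)
open import Data.Sum using (_⊎_; inj₁; inj₂; [_,_]′; map₂)
open import Data.Unit using (⊤; tt)
open import Function.Bundles using (module Bijection)
open import Function.Base using (_∘_)
open import Induction.WellFounded using (WellFounded; WfRec; module All; module FixPoint; module Subrelation)
import Relation.Binary.Construct.On as On
open import Relation.Binary.Core using (Rel)
open import Relation.Binary.Definitions using (tri<; tri≈; tri>)
open import Relation.Binary.PropositionalEquality using (_≡_; _≢_; refl; sym; trans; cong; cong₂; subst; subst₂; setoid)
open import Relation.Binary.Structures using (IsStrictTotalOrder)
open import Relation.Nullary using (Dec; yes; no)
open import Relation.Nullary.Decidable using (True; toWitness; fromWitness)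
open import Relation.Unary using (Pred; _∈_; _≐_; _∩_; U)
open import Relation.Unary.Properties using (≐-refl; ≐-sym; ≐-trans)

module Proof {ℓ : Level} (em : ∀ {a} → ExcludedMiddle a) (Λ : Ordinal ℓ) where

  open Below Λ
  open Ordinal Λ using (isStrictTotalOrder; wellFounded)
  open IsStrictTotalOrder isStrictTotalOrder using (compare; irrefl) renaming (trans to <-trans)

  private variable
    a i p q : Level

  -- Classical reasoning and the linear order of the ordinals.

  byContradiction : {A : Set a} → ¬ ¬ A → A
  byContradiction {A = A} ¬¬a with em {P = A}
  ... | yes a = a
  ... | no ¬a = ⊥-elim (¬¬a ¬a)

  -- Resizing by excluded middle: a proposition of any level becomes one at level `ℓ`, fit to define
  -- a `Subset`, and it acquires at most one proof.
  ⌊_⌋ : Set a → Set ℓ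
  ⌊ A ⌋ = Lift ℓ (True (em {P = A}))

  ⌊⌋-intro : {A : Set a} → A → ⌊ A ⌋
  ⌊⌋-intro a = lift (fromWitness a)

  ⌊⌋-elim : {A : Set a} → ⌊ A ⌋ → A
  ⌊⌋-elim (lift t) = toWitness t

  <-irrefl : ∀ {α} → ¬ α < α
  <-irrefl = irrefl refl

  <⇒≱ : ∀ {α β} → α < β → ¬ β ≤ α
  <⇒≱ α<β (inj₁ β<α) = <-irrefl (<-trans α<β β<α)
  <⇒≱ α<β (inj₂ refl) = <-irrefl α<β

  <-≤-trans : ∀ {α β γ} → α < β → β ≤ γ → α < γ
  <-≤-trans α<β (inj₁ β<γ) = <-trans α<β β<γ
  <-≤-trans α<β (inj₂ refl) = α<β

  ≤-<-trans : ∀ {α β γ} → α ≤ β → β < γ → α < γ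
  ≤-<-trans (inj₁ α<β) β<γ = <-trans α<β β<γ
  ≤-<-trans (inj₂ refl) β<γ = β<γ

  ≤-trans : ∀ {α β γ} → α ≤ β → β ≤ γ → α ≤ γ
  ≤-trans α≤β (inj₁ β<γ) = inj₁ (≤-<-trans α≤β β<γ)
  ≤-trans α≤β (inj₂ refl) = α≤β

  ≰⇒> : ∀ {α β} → ¬ α ≤ β → β < α
  ≰⇒> {α} {β} α≰β with compare α β
  ... | tri< α<β _ _ = ⊥-elim (α≰β (inj₁ α<β))
  ... | tri≈ _ α≡β _ = ⊥-elim (α≰β (inj₂ α≡β))
  ... | tri> _ _ β<α = β<α

  ≮⇒≥ : ∀ {α β} → ¬ α < β → β ≤ α
  ≮⇒≥ {α} {β} α≮β = byContradiction λ β≰α → α≮β (≰⇒> β≰α)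

  ≤-antisym : ∀ {α β} → α ≤ β → β ≤ α → α ≡ β
  ≤-antisym (inj₂ eq) _ = eq
  ≤-antisym (inj₁ α<β) β≤α = ⊥-elim (<⇒≱ α<β β≤α)

  max : Ord → Ord → Ord
  max α β with em {P = α ≤ β}
  ... | yes _ = β
  ... | no _ = α

  ≤-maxˡ : ∀ α β → α ≤ max α β
  ≤-maxˡ α β with em {P = α ≤ β}
  ... | yes α≤β = α≤β
  ... | no _ = inj₂ refl

  ≤-maxʳ : ∀ α β → β ≤ max α β
  ≤-maxʳ α β with em {P = α ≤ β}
  ... | yes _ = inj₂ refl
  ... | no α≰β = inj₁ (≰⇒> α≰β)

  max-pres : ∀ (P : Pred Ord p) {α β} → P α → P β → P (max α β)
  max-pres P {α} {β} Pα Pβ with em {P = α ≤ β}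
  ... | yes _ = Pβ
  ... | no _ = Pα

  <-induction : (P : Pred Ord p) → (∀ α → (∀ β → β < α → P β) → P α) → ∀ α → P α
  <-induction P step = All.wfRec wellFounded _ P λ α ih → step α λ β β<α → ih β<α

  IsLeast : Pred Ord p → Ord → Set (ℓ ⊔ p)
  IsLeast P α = P α × (∀ β → β < α → ¬ P β)

  least : (P : Pred Ord p) → ∃ P → ∃ (IsLeast P)
  least P (α , Pα) = byContradiction λ none →
    <-induction (λ β → ¬ P β) (λ β ih Pβ → none (β , Pβ , ih)) α Pα

  least-≤ : (P : Pred Ord p) → ∀ {α β} → IsLeast P α → P β → α ≤ β
  least-≤ P (_ , below) Pβ = ≮⇒≥ λ β<α → below _ β<α Pβ

  -- The witness given by `h` may depend on the proof of `Q ξ`. Deciding `Q ξ` by `em` fixes one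
  -- proof; outside `Q` the value is a dummy.
  choice : {Q : Pred Ord q} {R : Ord → Ord → Set p} → (∀ ξ → Q ξ → ∃ (R ξ)) →
           Σ (Ord → Ord) λ f → ∀ ξ → Q ξ → R ξ (f ξ)
  choice {Q = Q} {R} h = (λ ξ → pick ξ em) , λ ξ → spec ξ em
    where
    pick : ∀ ξ → Dec (Q ξ) → Ord
    pick ξ (yes Qξ) = proj₁ (h ξ Qξ)
    pick ξ (no _) = ξ
    spec : ∀ ξ (d : Dec (Q ξ)) → Q ξ → R ξ (pick ξ d)
    spec ξ (yes Qξ) _ = proj₂ (h ξ Qξ)
    spec ξ (no ¬Qξ) Qξ = ⊥-elim (¬Qξ Qξ)

  -- A choice function for `h` takes values in `I` and is not cofinal, so some `γ` in `I` exceeds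
  -- them all. `I` is `U` for regularity of λ and `↓ α` for arguments about cf(α).
  bounded : ∀ {I : Pred Ord i} {δ} {P : Ord → Ord → Set p} → ¬ HasCofinalMap δ I →
            (∀ ξ → ξ < δ → ∃[ η ] (I η × P ξ η)) →
            ∃[ γ ] (I γ × (∀ ξ → ξ < δ → ∃[ η ] (η < γ × P ξ η)))
  bounded {I = I} {δ} ¬cofinal h = byContradiction λ none → ¬cofinal
    ( f
    , (λ ξ ξ<δ → proj₁ (f-spec ξ ξ<δ))
    , λ γ γ∈I → byContradiction λ above → none
        (γ , γ∈I , λ ξ ξ<δ →
          f ξ , ≰⇒> (λ γ≤fξ → above (ξ , ξ<δ , γ≤fξ)) , proj₂ (f-spec ξ ξ<δ)))
    where
    f = proj₁ (choice h)
    f-spec = proj₂ (choice h)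

  cofinalIn⇒isSup : ∀ {C : Subset} {β} → (∀ τ → τ < β → ∃[ γ ] ((C ∩ ↓ β) γ × τ < γ)) →
                    IsSup (C ∩ ↓ β) β
  cofinalIn⇒isSup cof = (λ α α∈ → inj₁ (proj₂ α∈)) , λ τ upper → ≮⇒≥ λ τ<β →
    let γ , γ∈ , τ<γ = cof τ τ<β in <⇒≱ τ<γ (upper γ γ∈)

  isSup⇒cofinalIn : ∀ {C : Subset} {β} → IsSup (C ∩ ↓ β) β →
                    ∀ τ → τ < β → ∃[ γ ] ((C ∩ ↓ β) γ × τ < γ)
  isSup⇒cofinalIn (_ , least-upper) τ τ<β = byContradiction λ none →
    <⇒≱ τ<β (least-upper τ λ α α∈ → ≮⇒≥ λ τ<α → none (α , α∈ , τ<α))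

  -- Mostowski collapse and order types.

  mex : Ord → (P : Pred Ord ℓ) → Dec (∃[ η ] ¬ P η) → Ord
  mex o P (yes gap) = proj₁ (least _ gap)
  mex o P (no _) = o

  -- Stands in for function extensionality when the recursion behind `collapse` is unfolded.
  mex-cong : ∀ o {P Q : Pred Ord ℓ} → (∀ η → P η → Q η) → (∀ η → Q η → P η) →
             ∀ d d′ → mex o P d ≡ mex o Q d′
  mex-cong o P⊆Q Q⊆P (yes gap) (yes gap′) =
    let least-P = proj₂ (least _ gap) ; least-Q = proj₂ (least _ gap′)
    in ≤-antisym (least-≤ _ least-P (proj₁ least-Q ∘ P⊆Q _))
                 (least-≤ _ least-Q (proj₁ least-P ∘ Q⊆P _))
  mex-cong o P⊆Q Q⊆P (yes (η , η∉P)) (no full) = ⊥-elim (full (η , η∉P ∘ Q⊆P η))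
  mex-cong o P⊆Q Q⊆P (no full) (yes (η , η∉Q)) = ⊥-elim (full (η , η∉Q ∘ P⊆Q η))
  mex-cong o P⊆Q Q⊆P (no _) (no _) = refl

  -- The Mostowski collapse of a well-founded relation into Ord; the value o is
  -- only taken where the collapse would leave Ord.
  module Collapse (o : Ord) {A : Set ℓ} {_≺_ : Rel A ℓ} (≺-wellFounded : WellFounded _≺_) where

    private
      step : ∀ x → WfRec _≺_ (λ _ → Ord) x → Ord
      step x rec = mex o (λ η → ∃[ y ] Σ (y ≺ x) λ y≺x → rec y≺x ≡ η) em

      step-ext : ∀ x {rec rec′ : WfRec _≺_ (λ _ → Ord) x} →
                 (∀ {y} y≺x → rec {y} y≺x ≡ rec′ y≺x) → step x rec ≡ step x rec′
      step-ext x eq = mex-cong o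
        (λ η (y , y≺x , e) → y , y≺x , trans (sym (eq y≺x)) e)
        (λ η (y , y≺x , e) → y , y≺x , trans (eq y≺x) e) em em

    collapse : A → Ord
    collapse = All.wfRec ≺-wellFounded ℓ (λ _ → Ord) step

    Attained : A → Pred Ord ℓ
    Attained x η = ∃[ y ] (y ≺ x × collapse y ≡ η)

    collapse-least : ∀ x → ∃[ η ] ¬ Attained x η → IsLeast (λ η → ¬ Attained x η) (collapse x)
    collapse-least x gap =
      subst (IsLeast _)
        (sym (FixPoint.unfold-wfRec ≺-wellFounded (λ _ → Ord) step step-ext))
        (spec em)
      where
      spec : ∀ d → IsLeast (λ η → ¬ Attained x η) (mex o (Attained x) d)
      spec (yes gap′) = proj₂ (least _ gap′)
      spec (no full) = ⊥-elim (full gap)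

  record HasOrderType (D : Subset) (δ β : Ord) : Set ℓ where
    field
      position           : Ord → Ord
      position<          : ∀ {x} → D x → x < δ → position x < β
      position-injective : ∀ {x y} → D x → D y → position x ≡ position y → x ≡ y
      entry              : ∀ {η} → η < β → ∃[ x ] (D x × x < δ × position x ≡ η)

  orderType : ∀ D δ → ∃[ β ] (β ≤ δ × HasOrderType D δ β)
  orderType D δ = collapse δ , collapse-≤ δ , record
    { position = collapse
    ; position< = increasing
    ; position-injective = injective
    ; entry = λ η<β → let x , (x∈D , x<δ) , eq = attained δ η<β in x , x∈D , x<δ , eq
    }
    where
    -- Only elements of `D` count as predecessors, so `collapse` numbers `D` increasingly, and its
    -- value at `δ` is the order type of `D ∩ ↓ δ` even if `δ` is not in `D`.
    open Collapse δ {_≺_ = λ x y → D x × x < y}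
      (Subrelation.wellFounded proj₂ wellFounded)
    gap : ∀ x → (∀ y → y < x → collapse y ≤ y) → ¬ Attained x x
    gap x ih (y , (_ , y<x) , eq) = <⇒≱ (≤-<-trans (ih y y<x) y<x) (inj₂ (sym eq))
    collapse-≤ : ∀ x → collapse x ≤ x
    collapse-≤ = <-induction _ λ x ih → least-≤ _ (collapse-least x (x , gap x ih)) (gap x ih)
    isLeast : ∀ x → IsLeast (λ η → ¬ Attained x η) (collapse x)
    isLeast x = collapse-least x (x , gap x λ y _ → collapse-≤ y)
    attained : ∀ x {η} → η < collapse x → Attained x η
    attained x η<x = byContradiction (proj₂ (isLeast x) _ η<x)
    increasing : ∀ {x y} → D x → x < y → collapse x < collapse y
    increasing {x} {y} x∈D x<y = ≰⇒> λ
      { (inj₂ eq) → proj₁ (isLeast y) (x , (x∈D , x<y) , sym eq)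
      ; (inj₁ lt) → let z , (z∈D , z<x) , eq = attained x lt
                    in proj₁ (isLeast y) (z , (z∈D , <-trans z<x x<y) , eq) }
    injective : ∀ {x y} → D x → D y → collapse x ≡ collapse y → x ≡ y
    injective {x} {y} x∈D y∈D eq with compare x y
    ... | tri< x<y _ _ = ⊥-elim (irrefl eq (increasing x∈D x<y))
    ... | tri≈ _ x≡y _ = x≡y
    ... | tri> _ _ y<x = ⊥-elim (irrefl (sym eq) (increasing y∈D y<x))

  -- Collections with fewer than κ members.

  Embeds : Set ℓ → Ord → Set ℓ
  Embeds A δ = Σ (A → Ord) λ f → (∀ x → f x < δ) × (∀ x y → f x ≡ f y → x ≡ y)

  Range : {A : Set ℓ} → (A → Subset) → Collection
  Range T X = Lift (lsuc ℓ) (∃[ x ] X ≐ T x)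

  -- `T` may repeat sets and `f` may leave gaps, whereas `FewerThan` asks for a bijection with an
  -- initial segment. So each set is represented by its index of least `f`-value, and these values
  -- are numbered by their order type.
  range-fewerThan : ∀ {κ δ} {A : Set ℓ} (T : A → Subset) → δ < κ → Embeds A δ →
                    FewerThan κ (Range T)
  range-fewerThan {κ} {δ} {A} T δ<κ (f , f<δ , f-injective) =
    β , ≤-<-trans β≤δ δ<κ , record
      { to = to
      ; cong = λ {x} {y} → to-cong x y
      ; bijective = (λ {x} {y} → to-injective x y) , to-surjective
      }
    where
    Minimal : A → Set ℓ
    Minimal x = ∀ y → T y ≐ T x → f x ≤ f y
    D : Subset
    D ξ = ∃[ x ] (f x ≡ ξ × Minimal x)
    β = proj₁ (orderType D δ)
    β≤δ = proj₁ (proj₂ (orderType D δ))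
    open HasOrderType (proj₂ (proj₂ (orderType D δ)))
    at : ∃ (↓ β) → A
    at (_ , η<β) = proj₁ (proj₁ (proj₂ (entry η<β)))
    at-minimal : ∀ η → Minimal (at η)
    at-minimal (_ , η<β) = proj₂ (proj₂ (proj₁ (proj₂ (entry η<β))))
    at-position : ∀ η → position (f (at η)) ≡ proj₁ η
    at-position (_ , η<β) = trans (cong position (proj₁ (proj₂ (proj₁ (proj₂ (entry η<β))))))
                                  (proj₂ (proj₂ (proj₂ (entry η<β))))
    at-unique : ∀ η x → Minimal x → position (f x) ≡ proj₁ η → at η ≡ x
    at-unique η x min eq = f-injective _ _ (position-injective
      (at η , refl , at-minimal η) (x , refl , min) (trans (at-position η) (sym eq)))
    to : ∃ (↓ β) → ∃ (Range T)
    to η = T (at η) , lift (at η , ≐-refl)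
    to-cong : ∀ η η′ → proj₁ η ≡ proj₁ η′ → T (at η) ≐ T (at η′)
    to-cong η η′ eq = subst (λ x → T (at η) ≐ T x)
      (at-unique η (at η′) (at-minimal η′) (trans (at-position η′) (sym eq))) ≐-refl
    to-injective : ∀ η η′ → T (at η) ≐ T (at η′) → proj₁ η ≡ proj₁ η′
    to-injective η η′ eq = trans (sym (at-position η)) (trans
      (cong position (≤-antisym (at-minimal η _ (≐-sym eq)) (at-minimal η′ _ eq)))
      (at-position η′))
    to-surjective : ∀ (y : ∃ (Range T)) → ∃ λ η → ∀ {η′ : ∃ (↓ β)} → proj₁ η′ ≡ proj₁ η →
                    T (at η′) ≐ proj₁ y
    to-surjective (X , lift (x , X≐Tx)) =
      let ξ , (y , Ty≐Tx , fy≡ξ) , below = least (λ ξ → ∃[ y ] (T y ≐ T x × f y ≡ ξ)) (f x , x , ≐-refl , refl)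
          min : Minimal y
          min z Tz≐Ty = ≮⇒≥ λ fz<fy → below (f z) (subst (f z <_) fy≡ξ fz<fy)
            (z , ≐-trans Tz≐Ty Ty≐Tx , refl)
      in (position (f y) , position< (y , refl , min) (f<δ y)) , λ {η′} eq →
           ≐-trans (subst (λ z → T z ≐ T y) (sym (at-unique η′ y min (sym eq))) ≐-refl)
                   (≐-trans Ty≐Tx (≐-sym X≐Tx))

  -- The finite ordinals and chains of length ω.

  module Omega {w : Ord} (w-omega : IsOmega w) where

    finiteOrd : ℕ → ∃[ v ] v < w
    nextFinite : ∀ n → ∃ (IsLeast λ v → proj₁ (finiteOrd n) < v)
    finiteOrd zero = let v , (v<w , _) = least (↓ w) (proj₁ (proj₁ w-omega)) in v , v<w
    finiteOrd (suc n) = proj₁ (nextFinite n) , (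
      let v , v<w , gt = proj₂ (proj₁ w-omega) _ (proj₂ (finiteOrd n))
      in ≤-<-trans (least-≤ _ (proj₂ (nextFinite n)) gt) v<w)
    nextFinite n = least _ (
      let v , _ , gt = proj₂ (proj₁ w-omega) _ (proj₂ (finiteOrd n)) in v , gt)

    fin : ℕ → Ord
    fin n = proj₁ (finiteOrd n)

    fin<w : ∀ n → fin n < w
    fin<w n = proj₂ (finiteOrd n)

    fin-step : ∀ n → fin n < fin (suc n)
    fin-step n = proj₁ (proj₂ (nextFinite n))

    fin-mono : ∀ {m n} → m ℕ.< n → fin m < fin n
    fin-mono {n = suc n} m<1+n with ℕ.m<1+n⇒m<n∨m≡n m<1+n
    ... | inj₁ m<n = <-trans (fin-mono m<n) (fin-step n)
    ... | inj₂ refl = fin-step n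

    fin-injective : ∀ m n → fin m ≡ fin n → m ≡ n
    fin-injective m n eq with ℕ.<-cmp m n
    ... | tri< m<n _ _ = ⊥-elim (irrefl eq (fin-mono m<n))
    ... | tri≈ _ m≡n _ = m≡n
    ... | tri> _ _ n<m = ⊥-elim (irrefl (sym eq) (fin-mono n<m))

    -- No `v < w` is a limit, so a nonzero one has a largest element `u` below it and is the
    -- successor of `u`.
    fin-surjective : ∀ v → v < w → ∃[ n ] fin n ≡ v
    fin-surjective = <-induction _ λ v ih v<w → find v ih v<w em
      where
      find : ∀ v → (∀ u → u < v → u < w → ∃[ n ] fin n ≡ u) → v < w →
             Dec (∃[ u ] u < v) → ∃[ n ] fin n ≡ v
      find v ih v<w (no empty) = zero , ≤-antisym
        (least-≤ _ (proj₂ (least (↓ w) (proj₁ (proj₁ w-omega)))) v<w)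
        (≮⇒≥ λ lt → empty (_ , lt))
      find v ih v<w (yes inhabited) =
        let u , u<v , top = byContradiction λ none → proj₂ w-omega v v<w
              (inhabited , λ u u<v → byContradiction λ bound → none
                (u , u<v , λ t t<v → ≮⇒≥ λ u<t → bound (t , t<v , u<t)))
            n , fin-n≡u = ih u u<v (<-trans u<v v<w)
        in suc n , ≤-antisym
             (least-≤ _ (proj₂ (nextFinite n)) (subst (_< v) (sym fin-n≡u) u<v))
             (≮⇒≥ λ lt → <⇒≱ (fin-step n) (subst (fin (suc n) ≤_) (sym fin-n≡u) (top _ lt)))

    -- Iterates `step` along ω and takes the least strict upper bound `σ`, which stays in `I`
    -- because no map from `w` is cofinal there. `R` records what each step achieves.
    chain : ∀ {I : Pred Ord i} {R : Ord → Ord → Set p} → ¬ HasCofinalMap w I →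
            (∀ α → I α → ∃[ β ] (I β × α < β × R α β)) → (∀ {α β} → α < β → I β → I α) →
            ∀ α → I α →
            Σ (ℕ → Ord) λ s → s zero ≡ α × (∀ n → R (s n) (s (suc n))) ×
              ∃[ σ ] (I σ × (∀ n → s n < σ) × (∀ τ → τ < σ → ∃[ n ] τ < s n))
    chain {I = I} {R} ¬cofinal step down α α∈I =
      s , refl , (λ n → proj₂ (proj₂ (proj₂ (next n)))) ,
      σ , σ∈I , proj₁ (proj₂ σ-least) , below
      where
      seq : ℕ → ∃ I
      seq zero = α , α∈I
      seq (suc n) = let β , β∈I , _ = step _ (proj₂ (seq n)) in β , β∈I
      s : ℕ → Ord
      s n = proj₁ (seq n)
      next = λ n → step (s n) (proj₂ (seq n))
      bound : ∃[ γ ] (I γ × (∀ v → v < w → ∃[ η ] (η < γ × (∀ n → fin n ≡ v → η ≡ s n))))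
      bound = bounded ¬cofinal λ v v<w →
        let n , fin-n≡v = fin-surjective v v<w in
        s n , proj₂ (seq n) , λ m fin-m≡v → cong s (fin-injective n m (trans fin-n≡v (sym fin-m≡v)))
      upper : ∀ n → s n < proj₁ bound
      upper n = let η , η<γ , η≡ = proj₂ (proj₂ bound) (fin n) (fin<w n)
                in subst (_< proj₁ bound) (η≡ n refl) η<γ
      σ-least = least (λ γ → ∀ n → s n < γ) (_ , upper)
      σ = proj₁ σ-least
      σ∈I : I σ
      σ∈I = [ (λ σ<γ → down σ<γ (proj₁ (proj₂ bound)))
            , (λ σ≡γ → subst I (sym σ≡γ) (proj₁ (proj₂ bound))) ]′
            (least-≤ _ (proj₂ σ-least) upper)
      below : ∀ τ → τ < σ → ∃[ n ] τ < s n
      below τ τ<σ = byContradiction λ none → proj₂ (proj₂ σ-least) τ τ<σ λ n →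
        <-≤-trans (proj₁ (proj₂ (proj₂ (next n)))) (≮⇒≥ λ lt → none (suc n , lt))

  -- Cardinal arithmetic below κ.

  Segment : Ord → Set ℓ
  Segment μ = ∃[ ξ ] ⌊ ξ < μ ⌋

  segment-≡ : ∀ {μ} (x y : Segment μ) → proj₁ x ≡ proj₁ y → x ≡ y
  segment-≡ (ξ , lift t) (_ , lift t′) refl = cong (λ t → ξ , lift t) (T-irrelevant t t′)

  -- The closure properties used in building the index type of the final family. The instances are
  -- the finite types and the types that embed in a fixed infinite ordinal.
  record SizeClass (κ : Ord) : Set (lsuc ℓ) where
    field
      Small   : Set ℓ → Set ℓ
      ⊤-small : Small (Lift ℓ ⊤)
      ⊎-small : ∀ {A B} → Small A → Small B → Small (A ⊎ B)
      Σ-small : ∀ {A} {B : A → Set ℓ} → Small A → (∀ x → Small (B x)) → Small (Σ A B)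
      embeds  : ∀ {A} → Small A → ∃[ δ ] (δ < κ × Embeds A δ)

  record Pairing (ν : Ord) : Set ℓ where
    field
      pair           : Ord → Ord → Ord
      pair<          : ∀ {α β} → α < ν → β < ν → pair α β < ν
      pair-injective : ∀ {α β γ δ} → α < ν → β < ν → γ < ν → δ < ν →
                       pair α β ≡ pair γ δ → α ≡ γ × β ≡ δ

  -- With `s = m + n` the value lies between `s * s` and `s * s + s`, below the square of `s + 1`,
  -- so it determines `s` and then `m`.
  ℕ-pair : ℕ → ℕ → ℕ
  ℕ-pair m n = (m ℕ.+ n) ℕ.* (m ℕ.+ n) ℕ.+ m

  ℕ-pair-< : ∀ m n m′ n′ → m ℕ.+ n ℕ.< m′ ℕ.+ n′ → ℕ-pair m n ℕ.< ℕ-pair m′ n′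
  ℕ-pair-< m n m′ n′ lt = begin-strict
    s ℕ.* s ℕ.+ m                ≤⟨ ℕ.+-monoʳ-≤ (s ℕ.* s) (ℕ.m≤m+n m n) ⟩
    s ℕ.* s ℕ.+ s                ≡⟨ ℕ.+-comm (s ℕ.* s) s ⟩
    suc s ℕ.* s                  <⟨ ℕ.*-monoʳ-< (suc s) (ℕ.n<1+n s) ⟩
    suc s ℕ.* suc s              ≤⟨ ℕ.*-mono-≤ lt lt ⟩
    (m′ ℕ.+ n′) ℕ.* (m′ ℕ.+ n′)  ≤⟨ ℕ.m≤m+n _ m′ ⟩
    ℕ-pair m′ n′                 ∎
    where
    open ℕ.≤-Reasoning
    s = m ℕ.+ n

  ℕ-pair-injective : ∀ m n m′ n′ → ℕ-pair m n ≡ ℕ-pair m′ n′ → m ≡ m′ × n ≡ n′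
  ℕ-pair-injective m n m′ n′ eq with ℕ.<-cmp (m ℕ.+ n) (m′ ℕ.+ n′)
  ... | tri< lt _ _ = ⊥-elim (ℕ.<-irrefl eq (ℕ-pair-< m n m′ n′ lt))
  ... | tri> _ _ gt = ⊥-elim (ℕ.<-irrefl (sym eq) (ℕ-pair-< m′ n′ m n gt))
  ... | tri≈ _ sum≡ _ = m≡m′ , ℕ.+-cancelˡ-≡ m n n′ (trans sum≡ (cong (ℕ._+ n′) (sym m≡m′)))
    where
    m≡m′ : m ≡ m′
    m≡m′ = ℕ.+-cancelˡ-≡ _ m m′ (trans eq (cong (λ s → s ℕ.* s ℕ.+ m′) (sym sum≡)))

  module Sizes {w : Ord} (w-omega : IsOmega w) where

    open Omega w-omega

    index : ∀ v → ∃[ n ] (v < w → fin n ≡ v)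
    index v with em {P = v < w}
    ... | yes v<w = let n , eq = fin-surjective v v<w in n , λ _ → eq
    ... | no v≮w = zero , λ v<w → ⊥-elim (v≮w v<w)

    pairing-ω : Pairing w
    pairing-ω = record
      { pair = λ α β → fin (ℕ-pair (ι α) (ι β))
      ; pair< = λ {α} {β} _ _ → fin<w (ℕ-pair (ι α) (ι β))
      ; pair-injective = λ {α} {β} {γ} {δ} α<w β<w γ<w δ<w eq →
          let e , e′ = ℕ-pair-injective (ι α) (ι β) (ι γ) (ι δ) (fin-injective _ _ eq)
          in ι-injective α γ α<w γ<w e , ι-injective β δ β<w δ<w e′
      }
      where
      ι : Ord → ℕ
      ι v = proj₁ (index v)
      ι-injective : ∀ u v → u < w → v < w → ι u ≡ ι v → u ≡ v
      ι-injective u v u<w v<w eq =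
        trans (sym (proj₂ (index u) u<w)) (trans (cong fin eq) (proj₂ (index v) v<w))

    fin<ν : ∀ {ν} → w ≤ ν → ∀ n → fin n < ν
    fin<ν w≤ν n = <-≤-trans (fin<w n) w≤ν

    fin0≢fin1 : fin 0 ≢ fin 1
    fin0≢fin1 eq = irrefl eq (fin-step 0)

    module _ {ν : Ord} (w≤ν : w ≤ ν) (P : Pairing ν) where

      open Pairing P

      -- Injects ν + 1 into ν by tags. Gödel's ordering calls for it because the predecessors of a
      -- pair have coordinates up to and including its maximum.
      shift : Ord → Ord
      shift ξ with em {P = ξ ≡ ν}
      ... | yes _ = pair (fin 0) (fin 0)
      ... | no _ = pair (fin 1) ξ

      strict : ∀ {ξ} → ξ ≤ ν → ξ ≢ ν → ξ < ν
      strict (inj₁ ξ<ν) _ = ξ<ν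
      strict (inj₂ ξ≡ν) ξ≢ν = ⊥-elim (ξ≢ν ξ≡ν)

      shift< : ∀ {ξ} → ξ ≤ ν → shift ξ < ν
      shift< {ξ} ξ≤ν with em {P = ξ ≡ ν}
      ... | yes _ = pair< (fin<ν w≤ν 0) (fin<ν w≤ν 0)
      ... | no ξ≢ν = pair< (fin<ν w≤ν 1) (strict ξ≤ν ξ≢ν)

      shift-injective : ∀ {ξ η} → ξ ≤ ν → η ≤ ν → shift ξ ≡ shift η → ξ ≡ η
      shift-injective {ξ} {η} ξ≤ν η≤ν eq with em {P = ξ ≡ ν} | em {P = η ≡ ν}
      ... | yes ξ≡ν | yes η≡ν = trans ξ≡ν (sym η≡ν)
      ... | yes _ | no η≢ν = ⊥-elim (fin0≢fin1 (proj₁ (pair-injective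
              (fin<ν w≤ν 0) (fin<ν w≤ν 0) (fin<ν w≤ν 1) (strict η≤ν η≢ν) eq)))
      ... | no ξ≢ν | yes _ = ⊥-elim (fin0≢fin1 (sym (proj₁ (pair-injective
              (fin<ν w≤ν 1) (strict ξ≤ν ξ≢ν) (fin<ν w≤ν 0) (fin<ν w≤ν 0) eq))))
      ... | no ξ≢ν | no η≢ν = proj₂ (pair-injective
              (fin<ν w≤ν 1) (strict ξ≤ν ξ≢ν) (fin<ν w≤ν 1) (strict η≤ν η≢ν) eq)

      pairing-≤ : Σ (Ord → Ord → Ord) λ p →
        (∀ {α β} → α ≤ ν → β ≤ ν → p α β < ν) ×
        (∀ {α β γ δ} → α ≤ ν → β ≤ ν → γ ≤ ν → δ ≤ ν → p α β ≡ p γ δ → α ≡ γ × β ≡ δ)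
      pairing-≤ =
        (λ α β → pair (shift α) (shift β)) ,
        (λ α≤ν β≤ν → pair< (shift< α≤ν) (shift< β≤ν)) ,
        λ α≤ν β≤ν γ≤ν δ≤ν eq →
          let e , e′ = pair-injective (shift< α≤ν) (shift< β≤ν) (shift< γ≤ν) (shift< δ≤ν) eq
          in shift-injective α≤ν γ≤ν e , shift-injective β≤ν δ≤ν e′

    Shrinks : Ord → Ord → Set ℓ
    Shrinks ν μ = Σ (Ord → Ord) λ f →
      (∀ {α} → α < ν → f α < μ) × (∀ {α β} → α < ν → β < ν → f α ≡ f β → α ≡ β)

    -- Gödel's ordering of pairs, whose proper initial segments in ν × ν lie in
    -- squares of smaller ordinals.
    godelKey : Ord × Ord → Ord × Ord × Ord
    godelKey (α , β) = max α β , α , β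

    _≺_ : Rel (Ord × Ord) ℓ
    p ≺ q = ×-Lex _≡_ _<_ (×-Lex _≡_ _<_ _<_) (godelKey p) (godelKey q)

    ≺-wellFounded : WellFounded _≺_
    ≺-wellFounded = On.wellFounded godelKey
      (×-wellFounded wellFounded (×-wellFounded wellFounded wellFounded))

    ≺⇒max≤ : ∀ p q → p ≺ q → proj₁ (godelKey p) ≤ proj₁ (godelKey q)
    ≺⇒max≤ p q (inj₁ lt) = inj₁ lt
    ≺⇒max≤ p q (inj₂ (eq , _)) = inj₂ eq

    -- If the predecessors of some pair `p` attained every value below `ν`, then `ν` would inject
    -- into the pairs of ordinals up to some infinite `m < ν`, hence into `m` by the pairing already
    -- available there. This contradicts `initial`.
    pairing-initial : ∀ {ν} → w < ν → (∀ μ → μ < ν → w ≤ μ → Pairing μ) →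
                      (∀ μ → μ < ν → w ≤ μ → ¬ Shrinks ν μ) → Pairing ν
    pairing-initial {ν} w<ν smaller initial = record
      { pair = λ α β → collapse (α , β)
      ; pair< = λ α<ν β<ν → let η , η<ν , free = gap (_ , _) α<ν β<ν
                            in ≤-<-trans (least-≤ _ (isLeast (_ , _) α<ν β<ν) free) η<ν
      ; pair-injective = injective
      }
      where
      open Collapse w ≺-wellFounded
      gap : ∀ p → proj₁ p < ν → proj₂ p < ν → ∃[ η ] (η < ν × ¬ Attained p η)
      gap p p₁<ν p₂<ν = byContradiction λ none →
        let h : ∀ η → η < ν → ∃[ ϑ ] ∃[ q ] (q ≺ p × collapse q ≡ η × ϑ ≡ code q)
            h η η<ν = let q , q≺p , eq = byContradiction {A = Attained p η} λ free → none (η , η<ν , free)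
                      in code q , q , q≺p , eq , refl
            f , spec = choice h
        in initial m m<ν w≤m (f ,
             (λ {α} α<ν → let q , q≺p , _ , eq = spec α α<ν
                          in subst (_< m) (sym eq) (proj₁ (proj₂ closed) (fst≤ q q≺p) (snd≤ q q≺p))) ,
             λ {α} {β} α<ν β<ν fα≡fβ →
               let q , q≺p , q-eq , q-code = spec α α<ν
                   r , r≺p , r-eq , r-code = spec β β<ν
                   e₁ , e₂ = proj₂ (proj₂ closed) (fst≤ q q≺p) (snd≤ q q≺p) (fst≤ r r≺p) (snd≤ r r≺p)
                               (trans (sym q-code) (trans fα≡fβ r-code))
               in trans (sym q-eq) (trans (cong₂ (λ x y → collapse (x , y)) e₁ e₂) r-eq))
        where
        m = max (proj₁ (godelKey p)) w
        m<ν : m < ν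
        m<ν = max-pres (_< ν) (max-pres (_< ν) p₁<ν p₂<ν) w<ν
        w≤m : w ≤ m
        w≤m = ≤-maxʳ _ _
        closed = pairing-≤ w≤m (smaller m m<ν w≤m)
        code : Ord × Ord → Ord
        code q = proj₁ closed (proj₁ q) (proj₂ q)
        key≤ : ∀ q → q ≺ p → proj₁ (godelKey q) ≤ m
        key≤ q q≺p = ≤-trans (≺⇒max≤ q p q≺p) (≤-maxˡ _ _)
        fst≤ : ∀ q → q ≺ p → proj₁ q ≤ m
        fst≤ q q≺p = ≤-trans (≤-maxˡ _ _) (key≤ q q≺p)
        snd≤ : ∀ q → q ≺ p → proj₂ q ≤ m
        snd≤ q q≺p = ≤-trans (≤-maxʳ _ _) (key≤ q q≺p)
      isLeast : ∀ p → proj₁ p < ν → proj₂ p < ν → IsLeast (λ η → ¬ Attained p η) (collapse p)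
      isLeast p p₁<ν p₂<ν = collapse-least p (let η , _ , free = gap p p₁<ν p₂<ν in η , free)
      injective : ∀ {α β γ δ} → α < ν → β < ν → γ < ν → δ < ν →
                  collapse (α , β) ≡ collapse (γ , δ) → α ≡ γ × β ≡ δ
      injective {α} {β} {γ} {δ} α<ν β<ν γ<ν δ<ν eq
        with ×-compare sym compare (×-compare sym compare compare) (godelKey (α , β)) (godelKey (γ , δ))
      ... | tri< lt _ _ = ⊥-elim (proj₁ (isLeast (γ , δ) γ<ν δ<ν) (_ , lt , eq))
      ... | tri≈ _ e _ = proj₂ e
      ... | tri> _ _ gt = ⊥-elim (proj₁ (isLeast (α , β) α<ν β<ν) (_ , gt , sym eq))

    -- If `ν` injects into a smaller infinite `μ`, the pairing of `μ` is pulled back. Otherwise `ν`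
    -- is ω, settled by arithmetic, or an uncountable initial ordinal, settled by Gödel's ordering.
    pairing : ∀ ν → w ≤ ν → Pairing ν
    pairing = <-induction _ λ ν ih w≤ν → step ν ih w≤ν em
      where
      step : ∀ ν → (∀ μ → μ < ν → w ≤ μ → Pairing μ) → w ≤ ν →
             Dec (∃[ μ ] (μ < ν × w ≤ μ × Shrinks ν μ)) → Pairing ν
      step ν ih w≤ν (yes (μ , μ<ν , w≤μ , f , f< , f-injective)) = record
        { pair = λ α β → pair (f α) (f β)
        ; pair< = λ α<ν β<ν → <-trans (pair< (f< α<ν) (f< β<ν)) μ<ν
        ; pair-injective = λ α<ν β<ν γ<ν δ<ν eq →
            let e , e′ = pair-injective (f< α<ν) (f< β<ν) (f< γ<ν) (f< δ<ν) eq
            in f-injective α<ν γ<ν e , f-injective β<ν δ<ν e′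
        }
        where open Pairing (ih μ μ<ν w≤μ)
      step ν ih (inj₂ refl) (no _) = pairing-ω
      step ν ih (inj₁ w<ν) (no initial) =
        pairing-initial w<ν ih λ μ μ<ν w≤μ sh → initial (μ , μ<ν , w≤μ , sh)

    infiniteClass : ∀ {κ} ν → w ≤ ν → ν < κ → SizeClass κ
    infiniteClass ν w≤ν ν<κ = record
      { Small = λ A → Embeds A ν
      ; ⊤-small = (λ _ → fin 0) , (λ _ → fin<ν w≤ν 0) , λ _ _ _ → refl
      ; ⊎-small = λ (f , f< , f-inj) (g , g< , g-inj) →
          [ (λ x → pair (fin 0) (f x)) , (λ y → pair (fin 1) (g y)) ]′ ,
          (λ { (inj₁ x) → pair< (fin<ν w≤ν 0) (f< x) ; (inj₂ y) → pair< (fin<ν w≤ν 1) (g< y) }) ,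
          λ { (inj₁ x) (inj₁ x′) eq → cong inj₁ (f-inj x x′ (proj₂ (inj 0 0 (f< x) (f< x′) eq)))
            ; (inj₁ x) (inj₂ y) eq → ⊥-elim (fin0≢fin1 (proj₁ (inj 0 1 (f< x) (g< y) eq)))
            ; (inj₂ y) (inj₁ x) eq → ⊥-elim (fin0≢fin1 (sym (proj₁ (inj 1 0 (g< y) (f< x) eq))))
            ; (inj₂ y) (inj₂ y′) eq → cong inj₂ (g-inj y y′ (proj₂ (inj 1 1 (g< y) (g< y′) eq))) }
      ; Σ-small = λ (f , f< , f-inj) g →
          (λ (x , y) → pair (f x) (proj₁ (g x) y)) ,
          (λ (x , y) → pair< (f< x) (proj₁ (proj₂ (g x)) y)) ,
          λ { (x , y) (x′ , y′) eq →
              let e , e′ = pair-injective (f< x) (proj₁ (proj₂ (g x)) y) (f< x′) (proj₁ (proj₂ (g x′)) y′) eq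
              in combine g x x′ y y′ (f-inj x x′ e) e′ }
      ; embeds = λ small → ν , ν<κ , small
      }
      where
      open Pairing (pairing ν w≤ν)
      inj : ∀ m n {α β} → α < ν → β < ν → pair (fin m) α ≡ pair (fin n) β → fin m ≡ fin n × α ≡ β
      inj m n α<ν β<ν = pair-injective (fin<ν w≤ν m) α<ν (fin<ν w≤ν n) β<ν
      combine : ∀ {A} {B : A → Set ℓ} (g : ∀ x → Embeds (B x) ν) x x′ y y′ → x ≡ x′ →
                proj₁ (g x) y ≡ proj₁ (g x′) y′ → _≡_ {A = Σ A B} (x , y) (x′ , y′)
      combine g x _ y y′ refl eq = cong (x ,_) (proj₂ (proj₂ (g x)) y y′ eq)

    finiteClass : SizeClass w
    finiteClass = record
      { Small = λ A → Σ (List A) λ xs → ∀ x → x List.∈ xs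
      ; ⊤-small = lift tt ∷ [] , λ _ → here refl
      ; ⊎-small = λ (xs , all-x) (ys , all-y) →
          map inj₁ xs ++ map inj₂ ys ,
          λ { (inj₁ x) → ∈-++⁺ˡ (∈-map⁺ inj₁ (all-x x))
            ; (inj₂ y) → ∈-++⁺ʳ (map inj₁ xs) (∈-map⁺ inj₂ (all-y y)) }
      ; Σ-small = λ (xs , all-x) ys →
          concat (map (λ x → map (x ,_) (proj₁ (ys x))) xs) ,
          λ (x , y) → ∈-concat⁺′ (∈-map⁺ (x ,_) (proj₂ (ys x) y))
                                 (∈-map⁺ (λ x → map (x ,_) (proj₁ (ys x))) (all-x x))
      ; embeds = λ {A} (xs , all-x) →
          fin (length xs) , fin<w (length xs) ,
          (λ x → fin (toℕ (Any.index (all-x x)))) ,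
          (λ x → fin-mono (toℕ<n (Any.index (all-x x)))) ,
          λ x y eq → index-injective (setoid A) (all-x x) (all-x y) (toℕ-injective (fin-injective _ _ eq))
      }

    segment-finite : ∀ {μ} → μ < w → SizeClass.Small finiteClass (Segment μ)
    segment-finite {μ} μ<w = tabulate entry , λ (ξ , ξ<μ) → find ξ ξ<μ
      where
      m = proj₁ (fin-surjective μ μ<w)
      fin-m≡μ = proj₂ (fin-surjective μ μ<w)
      entry : Fin m → Segment μ
      entry k = fin (toℕ k) , ⌊⌋-intro (subst (fin (toℕ k) <_) fin-m≡μ (fin-mono (toℕ<n k)))
      find : ∀ ξ (ξ<μ : ⌊ ξ < μ ⌋) → (ξ , ξ<μ) List.∈ tabulate entry
      find ξ ξ<μ = subst (List._∈ tabulate entry)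
        (segment-≡ _ _ (trans (cong fin (toℕ-fromℕ< n<m)) fin-n≡ξ)) (∈-tabulate⁺ (fromℕ< n<m))
        where
        lt = ⌊⌋-elim ξ<μ
        n = proj₁ (fin-surjective ξ (<-trans lt μ<w))
        fin-n≡ξ = proj₂ (fin-surjective ξ (<-trans lt μ<w))
        n<m : n ℕ.< m
        n<m = ℕ.≰⇒> λ m≤n → [ (λ m<n → <-irrefl (<-trans (fin-mono m<n) fin-n<fin-m))
                            , (λ m≡n → irrefl (cong fin (sym m≡n)) fin-n<fin-m) ]′ (ℕ.m≤n⇒m<n∨m≡n m≤n)
          where
          fin-n<fin-m : fin n < fin m
          fin-n<fin-m = subst₂ _<_ (sym fin-n≡ξ) (sym fin-m≡μ) lt

    -- For singular κ the types of size < κ are not closed under Σ, so the size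
    -- is bounded by a fixed ν < κ unless κ = ω.
    sizeClass : ∀ {κ μ} → w ≤ κ → μ < κ →
                Σ (SizeClass κ) λ 𝒮 → SizeClass.Small 𝒮 (Segment μ)
    sizeClass (inj₂ refl) μ<w = finiteClass , segment-finite μ<w
    sizeClass {μ = μ} (inj₁ w<κ) μ<κ =
      infiniteClass (max μ w) (≤-maxʳ μ w) (max-pres (_< _) μ<κ w<κ) ,
      proj₁ , (λ (_ , ξ<μ) → <-≤-trans (⌊⌋-elim ξ<μ) (≤-maxˡ μ w)) , segment-≡

  -- The nonstationary ideal and Fodor's lemma.

  module Stationarity {w : Ord} (w-omega : IsOmega w) (regular : LengthIsRegular) where

    open Omega w-omega

    regular-bounded : ∀ {δ} {P : Ord → Ord → Set p} → (∀ ξ → ξ < δ → ∃ (P ξ)) →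
                      ∃[ γ ] (∀ ξ → ξ < δ → ∃[ η ] (η < γ × P ξ η))
    regular-bounded {δ = δ} h =
      let γ , _ , bound = bounded {I = U} (proj₂ (proj₂ regular) δ)
                            λ ξ ξ<δ → let η , Pξη = h ξ ξ<δ in η , tt , Pξη
      in γ , bound

    greater : ∀ α → ∃[ β ] α < β
    greater α = let β , _ , α<β = proj₂ (proj₁ regular) α tt in β , α<β

    NonStationary : Subset → Set (lsuc ℓ)
    NonStationary A = ∃[ C ] (IsClubIn U C × (∀ β → A β → ¬ C β))

    Positive : Subset → Set (lsuc ℓ)
    Positive A = ¬ NonStationary A

    stationary⇒positive : ∀ {A} → IsStationary A → Positive A
    stationary⇒positive (_ , meets) (C , club , disjoint) =
      let β , β∈A , β∈C = meets C club in disjoint β β∈A β∈C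

    positive⇒stationary : ∀ {A} → Positive A → IsStationary A
    positive⇒stationary pos = (λ _ → tt) , λ C club → byContradiction λ none →
      pos (C , club , λ β β∈A β∈C → none (β , β∈A , β∈C))

    nonStationary-⊆ : ∀ {A B : Subset} → (∀ β → A β → B β) → NonStationary B → NonStationary A
    nonStationary-⊆ A⊆B (C , club , disjoint) = C , club , λ β β∈A → disjoint β (A⊆B β β∈A)

    positive-⊆ : ∀ {A B : Subset} → (∀ β → A β → B β) → Positive A → Positive B
    positive-⊆ A⊆B pos = pos ∘ nonStationary-⊆ A⊆B

    positive⇒inhabited : ∀ {A} → Positive A → ∃ A
    positive⇒inhabited pos = byContradiction λ none → pos
      ((λ _ → Lift ℓ ⊤) , ((λ _ → tt) , (λ _ _ _ _ → lift tt) , λ β _ → β , lift tt , inj₂ refl) ,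
       λ β β∈A _ → none (β , β∈A))

    -- Normality of the ideal: the diagonal intersection of the clubs `C η` is club. For
    -- unboundedness, a step from `α` passes a point of `C η` for every `η < α`; after ω steps the
    -- limit `σ` is a limit of every `C η` with `η < σ`.
    diagonal-nonStationary : ∀ (N : Ord → Subset) δ → (∀ η → NonStationary (N η)) →
      NonStationary (λ β → β ≤ δ ⊎ ∃[ η ] (η < β × N η β))
    diagonal-nonStationary N δ ns = D , ((λ _ → tt) , closed , unbounded) , disjoint
      where
      C : Ord → Subset
      C η = proj₁ (ns η)
      C-closed : ∀ η → IsClosedIn U (C η)
      C-closed η = proj₁ (proj₂ (proj₁ (proj₂ (ns η))))
      C-unbounded : ∀ η → IsUnboundedIn U (C η)
      C-unbounded η = proj₂ (proj₂ (proj₁ (proj₂ (ns η))))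
      D : Subset
      D β = δ < β × (∀ η → η < β → C η β)
      disjoint : ∀ β → β ≤ δ ⊎ ∃[ η ] (η < β × N η β) → ¬ D β
      disjoint β (inj₁ β≤δ) (δ<β , _) = <⇒≱ δ<β β≤δ
      disjoint β (inj₂ (η , η<β , β∈N)) (_ , inC) = proj₂ (proj₂ (ns η)) β β∈N (inC η η<β)
      limit-of-C : ∀ β η → η < β → (∀ τ → τ < β → ∃[ γ ] (C η γ × γ < β × τ < γ)) → C η β
      limit-of-C β η η<β cof =
        let γ , γ∈C , γ<β , _ = cof η η<β in
        C-closed η β tt (γ , γ∈C , γ<β) (cofinalIn⇒isSup λ τ τ<β →
          let γ , γ∈C , γ<β , τ<γ = cof τ τ<β in γ , (γ∈C , γ<β) , τ<γ)
      closed : IsClosedIn U D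
      closed β _ (d , (δ<d , _) , d<β) sup = <-trans δ<d d<β , λ η η<β →
        limit-of-C β η η<β λ τ τ<β →
          let γ , ((_ , inC) , γ<β) , lt = isSup⇒cofinalIn sup (max τ η) (max-pres (_< β) τ<β η<β)
          in γ , inC η (≤-<-trans (≤-maxʳ τ η) lt) , γ<β , ≤-<-trans (≤-maxˡ τ η) lt
      step : ∀ α → ∃[ β ] (⊤ × α < β × (∀ η → η < α → ∃[ γ ] (γ < β × C η γ × α < γ)))
      step α =
        let α⁺ , α<α⁺ = greater α
            β , bound = regular-bounded {δ = α} {P = λ η γ → C η γ × α < γ} λ η _ →
              let γ , γ∈C , α⁺≤γ = C-unbounded η α⁺ tt in γ , γ∈C , <-≤-trans α<α⁺ α⁺≤γ
        in max α⁺ β , tt , <-≤-trans α<α⁺ (≤-maxˡ α⁺ β) , λ η η<α →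
             let γ , γ<β , rest = bound η η<α in γ , <-≤-trans γ<β (≤-maxʳ α⁺ β) , rest
      unbounded : IsUnboundedIn U D
      unbounded α _ =
        let s , s₀ , rel , σ , _ , upper , below =
              chain (proj₂ (proj₂ regular) w) (λ α _ → step α) (λ _ _ → tt) (max α δ) tt
            lt = subst (_< σ) s₀ (upper zero)
        in σ , (≤-<-trans (≤-maxʳ α δ) lt , λ η η<σ → limit-of-C σ η η<σ λ τ τ<σ →
             -- Past `η` so that stage `n` treats `C η`, past `τ` so that the point found there
             -- exceeds `τ`.
             let n , lt′ = below (max τ η) (max-pres (_< σ) τ<σ η<σ)
                 γ , γ<s , γ∈C , s<γ = rel n η (≤-<-trans (≤-maxʳ τ η) lt′)
             in γ , γ∈C , <-trans γ<s (upper (suc n)) ,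
                <-trans (≤-<-trans (≤-maxˡ τ η) lt′) s<γ) ,
           inj₁ (≤-<-trans (≤-maxˡ α δ) lt)

    -- Were every `N η` nonstationary, so would be their diagonal union, which with the points up to
    -- `δ` covers `T`. A cover replaces the regressive function, so no value has to be chosen.
    fodor : ∀ {T : Subset} (N : Ord → Subset) δ → Positive T →
            (∀ β → T β → δ < β → ∃[ η ] (η < β × N η β)) → ∃[ η ] Positive (N η)
    fodor N δ pos press = byContradiction λ none → pos (nonStationary-⊆
      (λ β β∈T → map₂ (press β β∈T) (≤-or-> β))
      (diagonal-nonStationary N δ λ η → byContradiction λ posN → none (η , posN)))
      where
      ≤-or-> : ∀ β → β ≤ δ ⊎ δ < β
      ≤-or-> β with em {P = β ≤ δ}
      ... | yes le = inj₁ le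
      ... | no nle = inj₂ (≰⇒> nle)

    -- Completeness of the ideal: for `β` above `ζ`, an index below `ζ` is regressive. With `η < ζ`
    -- built into the sets, the bound is read off from any point of the one found.
    positive-⋃ : ∀ {T : Subset} (N : Ord → Subset) ζ → Positive T →
                 (∀ β → T β → ∃[ η ] (η < ζ × N η β)) → ∃[ η ] (η < ζ × Positive (N η))
    positive-⋃ N ζ pos cover =
      let η , posN = fodor (λ η β → η < ζ × N η β) ζ pos λ β β∈T ζ<β →
            let η , η<ζ , β∈N = cover β β∈T in η , <-trans η<ζ ζ<β , η<ζ , β∈N
      in η , proj₁ (proj₂ (positive⇒inhabited posN)) , positive-⊆ (λ _ → proj₂) posN

    positive-above : ∀ {T : Subset} δ → Positive T → Positive (λ β → T β × δ < β)
    positive-above {T} δ pos = proj₂ (fodor (λ _ β → T β × δ < β) δ pos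
      λ β β∈T δ<β → δ , δ<β , β∈T , δ<β)

    positive-∪ : ∀ {T A B : Subset} → Positive T → (∀ β → T β → A β ⊎ B β) → Positive A ⊎ Positive B
    positive-∪ {T} {A} {B} pos cover = decide
        (positive-⋃ (λ η β → (η ≡ o × A β) ⊎ (η ≢ o × B β)) o₂ pos λ β β∈T → split β (cover β β∈T))
      where
      -- `o` and `o₁` are labels for `A` and `B`.
      o = proj₁ (proj₁ (proj₁ regular))
      o₁ = proj₁ (greater o)
      o<o₁ = proj₂ (greater o)
      o₂ = proj₁ (greater o₁)
      o₁<o₂ = proj₂ (greater o₁)
      split : ∀ β → A β ⊎ B β → ∃[ η ] (η < o₂ × ((η ≡ o × A β) ⊎ (η ≢ o × B β)))
      split β (inj₁ β∈A) = o , <-trans o<o₁ o₁<o₂ , inj₁ (refl , β∈A)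
      split β (inj₂ β∈B) = o₁ , o₁<o₂ , inj₂ ((λ eq → irrefl (sym eq) o<o₁) , β∈B)
      decide : ∃[ η ] (η < o₂ × Positive (λ β → (η ≡ o × A β) ⊎ (η ≢ o × B β))) →
               Positive A ⊎ Positive B
      decide (η , _ , posN) with em {P = η ≡ o}
      ... | yes eq = inj₁ (positive-⊆ (λ { β (inj₁ (_ , β∈A)) → β∈A ; β (inj₂ (neq , _)) → ⊥-elim (neq eq) }) posN)
      ... | no neq = inj₂ (positive-⊆ (λ { β (inj₁ (eq , _)) → ⊥-elim (neq eq) ; β (inj₂ (_ , β∈B)) → β∈B }) posN)

  -- Trapping ranks by simultaneous reflection.

  module Trapping {w : Ord} (w-omega : IsOmega w) (regular : LengthIsRegular)
    {κ : Ord} (𝒮 : SizeClass κ) {J : Set ℓ} (J-small : SizeClass.Small 𝒮 J) (r : Ord → J → Ord)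
    {S : Subset} (S-positive : Stationarity.Positive w-omega regular S) where

    open Stationarity w-omega regular
    open SizeClass 𝒮

    -- Sets that are to reflect together, and candidates for a rank. Both share one small index
    -- type: an entry added for its set carries an arbitrary value, one added for its value carries
    -- `S`.
    record Family : Set (lsuc ℓ) where
      field
        Index       : Set ℓ
        index-small : Small Index
        set         : Index → Subset
        value       : Index → Ord
        set-⊆       : ∀ i β → set i β → S β
        positive    : ∀ i → Positive (set i)

    open Family

    -- With `r β j` the rank of the trace of the `j`-th member of `𝒞 β`, this is what reflection of
    -- `T` at α yields when `ϱ < α` is the rank of the trace of a member of `𝒞 α`.
    Hits : Subset → Ord → Set ℓ
    Hits T ϱ = ∃[ β ] (T β × ϱ < β × ∃[ j ] r β j ≡ ϱ)

    Traps : Family → Ord → Set ℓ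
    Traps F ϱ = (∀ i → Hits (set F i) ϱ) → ∃[ i ] value F i ≡ ϱ

    singleton : Ord → Family
    singleton ϱ = record
      { Index = Lift ℓ ⊤ ; index-small = ⊤-small ; set = λ _ → S ; value = λ _ → ϱ
      ; set-⊆ = λ _ _ β∈S → β∈S ; positive = λ _ → S-positive }

    union : {K : Set ℓ} → Small K → (K → Family) → Family
    union K-small F = record
      { Index = Σ _ λ k → Index (F k)
      ; index-small = Σ-small K-small λ k → index-small (F k)
      ; set = λ (k , i) → set (F k) i
      ; value = λ (k , i) → value (F k) i
      ; set-⊆ = λ (k , i) → set-⊆ (F k) i
      ; positive = λ (k , i) → positive (F k) i }

    insert : ∀ {T} → (∀ β → T β → S β) → Positive T → Ord → Family → Family
    insert {T} T⊆S T-positive ϱ F = record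
      { Index = Lift ℓ ⊤ ⊎ Index F
      ; index-small = ⊎-small ⊤-small (index-small F)
      ; set = [ (λ _ → T) , set F ]′
      ; value = [ (λ _ → ϱ) , value F ]′
      ; set-⊆ = λ { (inj₁ _) → T⊆S ; (inj₂ i) → set-⊆ F i }
      ; positive = λ { (inj₁ _) → T-positive ; (inj₂ i) → positive F i } }

    union-traps : ∀ {K} (K-small : Small K) F k {ϱ} → Traps (F k) ϱ → Traps (union K-small F) ϱ
    union-traps K-small F k traps hits =
      let i , eq = traps (λ i → hits (k , i)) in (k , i) , eq

    insert-traps : ∀ {T} (T⊆S : ∀ β → T β → S β) (T-positive : Positive T) ϱ₀ F {ϱ} →
                   (Hits T ϱ → Traps F ϱ) → Traps (insert T⊆S T-positive ϱ₀ F) ϱ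
    insert-traps T⊆S T-positive ϱ₀ F traps hits =
      let i , eq = traps (hits (inj₁ (lift tt))) (λ i → hits (inj₂ i)) in inj₂ i , eq

    TrapsBelow : Ord → Set (lsuc ℓ)
    TrapsBelow ζ = Σ Family λ F → ∀ ϱ → ϱ < ζ → Traps F ϱ

    -- Values of `f` outside `ζ` are tolerated, so that `r β` on all of `J` is a candidate for `f`.
    SmallCofinality : Ord → Set (lsuc ℓ)
    SmallCofinality ζ = Σ (Set ℓ) λ K → Small K × Σ (K → Ord) λ f →
      ∀ ϱ → ϱ < ζ → ∃[ k ] (f k < ζ × ϱ ≤ f k)

    trapsBelow-step : ∀ ζ → (∀ η → η < ζ → TrapsBelow η) → Dec (SmallCofinality ζ) → TrapsBelow ζ
    trapsBelow-step ζ ih (yes (K , K-small , f , cofinal)) =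
      union K-small (λ k → family k em) , λ ϱ ϱ<ζ →
        let k , fk<ζ , ϱ≤fk = cofinal ϱ ϱ<ζ
        in union-traps K-small (λ k → family k em) k (family-traps k em fk<ζ ϱ ϱ≤fk)
      where
      family : ∀ k → Dec (f k < ζ) → Family
      -- The value `f k` is added because the induction hypothesis covers only ranks strictly below
      -- `f k`, while cofinality gives `ϱ ≤ f k`. Successors thus need no separate case.
      family k (yes fk<ζ) = insert (λ _ β∈S → β∈S) S-positive (f k) (proj₁ (ih (f k) fk<ζ))
      family k (no _) = singleton ζ
      family-traps : ∀ k d → f k < ζ → ∀ ϱ → ϱ ≤ f k → Traps (family k d) ϱ
      family-traps k (yes fk<ζ) _ ϱ (inj₁ ϱ<fk) = insert-traps (λ _ β∈S → β∈S) S-positive (f k) (proj₁ (ih (f k) fk<ζ))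
        λ _ → proj₂ (ih (f k) fk<ζ) ϱ ϱ<fk
      family-traps k (yes fk<ζ) _ ϱ (inj₂ ϱ≡fk) _ = inj₁ (lift tt) , sym ϱ≡fk
      family-traps k (no fk≮ζ) fk<ζ = ⊥-elim (fk≮ζ fk<ζ)
    trapsBelow-step ζ ih (no large) =
      let η , η<ζ , T-positive = positive-⋃ T ζ S-positive λ β β∈S → bound β β∈S
          F , F-traps = ih η η<ζ
      in insert (λ _ → proj₁) T-positive ζ F , λ ϱ ϱ<ζ → insert-traps (λ _ → proj₁) T-positive ζ F
           -- At a point of `T η` the ranks below `ζ` lie below `η`, so a hit gives `ϱ < η`.
           λ (β , (_ , below) , _ , j , eq) →
             F-traps ϱ (subst (_< η) eq (below j (subst (_< ζ) (sym eq) ϱ<ζ)))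
      where
      T : Ord → Subset
      T η β = S β × (∀ j → r β j < ζ → r β j < η)
      bound : ∀ β → S β → ∃[ η ] (η < ζ × T η β)
      bound β β∈S = byContradiction λ none → large (J , J-small , r β , λ ϱ ϱ<ζ →
        byContradiction λ noneAbove → none (ϱ , ϱ<ζ , β∈S , λ j rj<ζ →
          ≰⇒> λ ϱ≤rj → noneAbove (j , rj<ζ , ϱ≤rj)))

    trapsBelow : ∀ ζ → TrapsBelow ζ
    trapsBelow = <-induction TrapsBelow λ ζ ih → trapsBelow-step ζ ih em

    -- A hit has `ϱ < β`, so at `β` only the ranks below `β` matter. Their bound is regressive,
    -- hence a constant `η` on a stationary set; once that set is added, only ranks below `η` can
    -- hit and `trapsBelow η` applies.
    traps : (∀ β → S β → ∃[ η ] (η < β × (∀ j → r β j < β → r β j < η))) →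
            Σ Family λ F → ∀ ϱ → Traps F ϱ
    traps bound =
      let η , T-positive = fodor T w S-positive λ β β∈S _ →
            let η , η<β , below = bound β β∈S in η , η<β , β∈S , below
          F , F-traps = trapsBelow η
      in insert (λ _ → proj₁) T-positive w F , λ ϱ → insert-traps (λ _ → proj₁) T-positive w F
           λ (β , (_ , below) , ϱ<β , j , eq) →
             F-traps ϱ (subst (_< η) eq (below j (subst (_< β) (sym eq) ϱ<β)))
      where
      T : Ord → Subset
      T η β = S β × (∀ j → r β j < β → r β j < η)

  -- Coherent sequences, reflection and threads.

  module CoherentSequence {w : Ord} (w-omega : IsOmega w) (regular : LengthIsRegular)
    {κ : Ord} (w≤κ : w ≤ κ) {𝒞 : Ord → Collection} (coherence : IsCoherentSequence κ 𝒞) where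

    open Omega w-omega
    open Sizes w-omega
    open Stationarity w-omega regular
    open IsCoherentSequence coherence

    size : Ord → Ord
    size β = proj₁ (width β)

    size<κ : ∀ β → size β < κ
    size<κ β = proj₁ (proj₂ (width β))

    module _ (β : Ord) where

      open Bijection (proj₂ (proj₂ (width β))) using (to; surjective)

      member′ : ∀ ξ → Dec (ξ < size β) → Subset
      member′ ξ (yes ξ<) = proj₁ (to (ξ , ξ<))
      member′ ξ (no _) = λ _ → Lift ℓ ⊥

      member : Ord → Subset
      member ξ = member′ ξ em

      member-∈ : ∀ ξ → ξ < size β → 𝒞 β (member ξ)
      member-∈ ξ ξ< = go em
        where
        go : ∀ d → 𝒞 β (member′ ξ d)
        go (yes p) = proj₂ (to (ξ , p))
        go (no ξ≮) = ⊥-elim (ξ≮ ξ<)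

      member-covers : ∀ C → 𝒞 β C → ∃[ ξ ] (ξ < size β × member ξ ≐ C)
      member-covers C C∈ = let (ξ , ξ<) , hit = surjective (C , C∈) in ξ , ξ< , go ξ ξ< hit em
        where
        go : ∀ ξ → ξ < size β → (∀ {z} → proj₁ z ≡ ξ → proj₁ (to z) ≐ C) →
             ∀ d → member′ ξ d ≐ C
        go ξ ξ< hit (yes p) = hit refl
        go ξ ξ< hit (no ξ≮) = ⊥-elim (ξ≮ ξ<)

    cf-bounded : ∀ {β δ} {P : Ord → Ord → Set p} → Cf≥ κ β → δ < κ →
                 (∀ ξ → ξ < δ → ∃[ η ] (η < β × P ξ η)) →
                 ∃[ γ ] (γ < β × (∀ ξ → ξ < δ → ∃[ η ] (η < γ × P ξ η)))
    cf-bounded (_ , (_ , minimal) , κ≤c) δ<κ = bounded (minimal _ (<-≤-trans δ<κ κ≤c))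

    cf-inhabited : ∀ {β} → Cf≥ κ β → ∃[ η ] η < β
    cf-inhabited (_ , ((f , f< , _) , _) , κ≤c) =
      f (fin 0) , f< (fin 0) (<-≤-trans (fin<ν w≤κ 0) κ≤c)

    Separates : Ord → Ord → Set (lsuc ℓ)
    Separates γ β = ∀ C C′ → 𝒞 β C → 𝒞 β C′ → (C ∩ ↓ γ) ≐ (C′ ∩ ↓ γ) → C ≐ C′

    ∩↓-cong : ∀ {C C′ : Subset} γ → C ≐ C′ → (C ∩ ↓ γ) ≐ (C′ ∩ ↓ γ)
    ∩↓-cong γ (C⊆C′ , C′⊆C) = (λ (x , lt) → C⊆C′ x , lt) , λ (x , lt) → C′⊆C x , lt

    ∩↓-absorb : ∀ {C : Subset} {γ β} → γ ≤ β → ((C ∩ ↓ β) ∩ ↓ γ) ≐ (C ∩ ↓ γ)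
    ∩↓-absorb γ≤β = (λ ((x , _) , lt) → x , lt) , λ (x , lt) → (x , <-≤-trans lt γ≤β) , lt

    -- Distinct members differ at a point below `β`, and there are fewer than κ of them while cf(β)
    -- is at least κ. Bounding over `ζ` for each `ξ`, and then over `ξ`, avoids counting pairs.
    separated : ∀ β → Cf≥ κ β → ∃[ γ ] (γ < β × Separates γ β)
    separated β cf =
      let γ , γ<β , bound = cf-bounded {P = λ ξ γ → ∀ ζ → ζ < size β → ∃[ η ] (η < γ × Distinguishes ξ ζ η)}
            cf (size<κ β) λ ξ ξ< → cf-bounded cf (size<κ β) λ ζ ζ< → distinguish ξ ζ ξ< ζ<
      in γ , γ<β , λ C C′ C∈ C′∈ agree →
           let ξ , ξ< , ξ≐C = member-covers β C C∈
               ζ , ζ< , ζ≐C′ = member-covers β C′ C′∈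
               γ′ , γ′<γ , bound′ = bound ξ ξ<
               η , η<γ′ , dist = bound′ ζ ζ<
           in ≐-trans (≐-sym ξ≐C) (≐-trans
                (dist γ (<-trans η<γ′ γ′<γ)
                  (≐-trans (∩↓-cong γ ξ≐C) (≐-trans agree (∩↓-cong γ (≐-sym ζ≐C′)))))
                ζ≐C′)
      where
      -- Trivial for equal members; otherwise any point of difference serves as `η`. Quantifying
      -- over `γ` allows `η` to be replaced by a larger bound.
      Distinguishes : Ord → Ord → Ord → Set ℓ
      Distinguishes ξ ζ η = ∀ γ → η < γ → (member β ξ ∩ ↓ γ) ≐ (member β ζ ∩ ↓ γ) → member β ξ ≐ member β ζ
      below : ∀ {ξ} → ξ < size β → ∀ {η} → member β ξ η → η < β
      below ξ< = proj₁ (clubs β _ (member-∈ β _ ξ<))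
      distinguish : ∀ ξ ζ → ξ < size β → ζ < size β → ∃[ η ] (η < β × Distinguishes ξ ζ η)
      distinguish ξ ζ ξ< ζ< = byContradiction λ none →
        let o , o<β = cf-inhabited cf in none (o , o<β , λ _ _ _ →
          (λ {η} ξ∋η → byContradiction λ ζ∌η → none (η , below ξ< ξ∋η , λ γ η<γ agree →
            ⊥-elim (ζ∌η (proj₁ (proj₁ agree (ξ∋η , η<γ)))))) ,
          (λ {η} ζ∋η → byContradiction λ ξ∌η → none (η , below ζ< ζ∋η , λ γ η<γ agree →
            ⊥-elim (ξ∌η (proj₁ (proj₂ agree (ζ∋η , η<γ)))))))

    -- As cf(α) is uncountable, the limit points of `C` above `δ` form a club `E` in α. The
    -- stationary `T` meets it, and coherence applies at the common point.
    reflection-meets : ∀ {T α C} → ReflectsAt T α → 𝒞 α C → ∀ δ → δ < α →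
                       ∃[ β ] (T β × δ < β × β < α × 𝒞 β (C ∩ ↓ β))
    reflection-meets {T} {α} {C} ((_ , (_ , minimal) , w′ , w′-omega , w′<c) , _ , meets) C∈ δ δ<α =
      let β , (β∈T , β<α) , (δ<β , _ , limit) = meets E ((λ e → proj₁ (proj₂ e)) , closed , unbounded)
      in β , β∈T , δ<β , β<α , coherent α C C∈ β
           (C-unbounded β β<α , cofinalIn⇒isSup limit)
      where
      module ω′ = Omega w′-omega
      ¬cofinal : ¬ HasCofinalMap w′ (↓ α)
      ¬cofinal = minimal w′ w′<c
      C-unbounded : IsUnboundedIn (↓ α) C
      C-unbounded = proj₂ (proj₂ (clubs α C C∈))
      E : Subset
      E β = δ < β × β < α × (∀ τ → τ < β → ∃[ γ ] ((C ∩ ↓ β) γ × τ < γ))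
      closed : IsClosedIn (↓ α) E
      closed β β<α (e , (δ<e , _) , e<β) sup = <-trans δ<e e<β , β<α , λ τ τ<β →
        let e , ((_ , _ , limit) , e<β) , τ<e = isSup⇒cofinalIn sup τ τ<β
            γ , (γ∈C , γ<e) , τ<γ = limit τ τ<e
        in γ , (γ∈C , <-trans γ<e e<β) , τ<γ
      greater′ : ∀ η → η < α → ∃[ ζ ] (ζ < α × η < ζ)
      greater′ η η<α =
        let ζ , ζ<α , bound = bounded {P = λ _ ξ → ξ ≡ η} ¬cofinal λ _ _ → η , η<α , refl
            ξ , ξ<ζ , ξ≡η = bound (ω′.fin 0) (ω′.fin<w 0)
        in ζ , ζ<α , subst (_< ζ) ξ≡η ξ<ζ
      step : ∀ η → η < α → ∃[ ζ ] (ζ < α × η < ζ × ∃[ γ ] (C γ × η < γ × γ < ζ))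
      step η η<α =
        let η⁺ , η⁺<α , η<η⁺ = greater′ η η<α
            γ , γ∈C , η⁺≤γ = C-unbounded η⁺ η⁺<α
            ζ , ζ<α , γ<ζ = greater′ γ (proj₁ (clubs α C C∈) γ∈C)
            η<γ = <-≤-trans η<η⁺ η⁺≤γ
        in ζ , ζ<α , <-trans η<γ γ<ζ , γ , γ∈C , η<γ , γ<ζ
      unbounded : IsUnboundedIn (↓ α) E
      unbounded β β<α =
        let s , s₀ , rel , σ , σ<α , upper , below =
              ω′.chain ¬cofinal step <-trans (max β δ) (max-pres (_< α) β<α δ<α)
            lt = subst (_< σ) s₀ (upper zero)
        in σ , (≤-<-trans (≤-maxʳ β δ) lt , σ<α , λ τ τ<σ →
             let n , τ<s = below τ τ<σ
                 γ , γ∈C , s<γ , γ<s = rel n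
             in γ , (γ∈C , <-trans γ<s (upper (suc n))) , <-trans τ<s s<γ) ,
           inj₁ (≤-<-trans (≤-maxˡ β δ) lt)

    -- Closedness, unboundedness and coherence at a point are inherited from a club in `𝒞 β` that
    -- agrees with `D` below some larger `β`.
    thread : ∀ D → (∀ α → ∃[ β ] (α < β × ∃[ C ] (𝒞 β C × (C ∩ ↓ β) ≐ (D ∩ ↓ β)))) → IsThread 𝒞 D
    thread D approximate = ((λ _ → tt) , closed , unbounded) , coheres
      where
      module _ {β : Ord} {C : Subset} (agree : (C ∩ ↓ β) ≐ (D ∩ ↓ β)) where
        C⇒D : ∀ {ξ} → ξ < β → C ξ → D ξ
        C⇒D lt x = proj₁ (proj₁ agree (x , lt))
        D⇒C : ∀ {ξ} → ξ < β → D ξ → C ξ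
        D⇒C lt x = proj₁ (proj₂ agree (x , lt))
        transferSup : ∀ {α} → α < β → IsSup (D ∩ ↓ α) α → IsSup (C ∩ ↓ α) α
        transferSup α<β sup = cofinalIn⇒isSup λ τ τ<α →
          let γ , (γ∈D , γ<α) , τ<γ = isSup⇒cofinalIn sup τ τ<α
          in γ , (D⇒C (<-trans γ<α α<β) γ∈D , γ<α) , τ<γ
      closed : IsClosedIn U D
      closed α _ (d , d∈D , d<α) sup =
        let β , α<β , C , C∈ , agree = approximate α
        in C⇒D agree α<β (proj₁ (proj₂ (clubs β C C∈)) α α<β
             (d , D⇒C agree (<-trans d<α α<β) d∈D , d<α) (transferSup agree α<β sup))
      unbounded : IsUnboundedIn U D
      unbounded α _ =
        let β , α<β , C , C∈ , agree = approximate α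
            γ , γ∈C , α≤γ = proj₂ (proj₂ (clubs β C C∈)) α α<β
        in γ , C⇒D agree (proj₁ (clubs β C C∈) γ∈C) γ∈C , α≤γ
      coheres : ∀ α → α ∈ acc D → 𝒞 α (D ∩ ↓ α)
      coheres α ((d , d∈D , α≤d) , sup) =
        -- Going beyond `d` puts `d` into `C`, where it witnesses that `α` belongs to `acc C`.
        let β , d<β , C , C∈ , agree = approximate d
            α<β = ≤-<-trans α≤d d<β
        in extensional α
             ((λ (x , lt) → C⇒D agree (<-trans lt α<β) x , lt) ,
              (λ (x , lt) → D⇒C agree (<-trans lt α<β) x , lt))
             (coherent β C C∈ α ((d , D⇒C agree d<β d∈D , α≤d) , transferSup agree α<β sup))

    -- Traces, branches and their splitting.

    module Uniform (unthreaded : ¬ ∃ (IsThread 𝒞)) {S : Subset} (S⊆Cf : S ⊆ Cf≥ κ)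
      {μ γ : Ord} (μ<κ : μ < κ)
      (uniform : ∀ β → S β → size β ≡ μ × γ < β × Separates γ β) (S-positive : Positive S) where

      -- Members are addressed by indices below `μ`; quantifying over subsets would leave level `ℓ`.
      Trace : Subset → Subset
      Trace z β = S β × ∃[ ξ ] (ξ < μ × (member β ξ ∩ ↓ γ) ≐ z)

      trace : ∀ {β z} {C : Subset} → S β → 𝒞 β (C ∩ ↓ β) → (C ∩ ↓ γ) ≐ z → Trace z β
      trace {β} {C = C} β∈S C∈ C≐z =
        let size≡μ , γ<β , _ = uniform β β∈S
            ξ , ξ< , ξ≐C = member-covers β (C ∩ ↓ β) C∈
        in β∈S , ξ , subst (ξ <_) size≡μ ξ< ,
           ≐-trans (∩↓-cong γ ξ≐C) (≐-trans (∩↓-absorb {C = C} (inj₁ γ<β)) C≐z)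

      -- The union of the members with trace `z`. For `β` in `S` there is at most one, as `γ`
      -- separates them, and the union names it without a choice.
      branch : Subset → Ord → Subset
      branch z β η = ∃[ ξ ] (ξ < μ × (member β ξ ∩ ↓ γ) ≐ z × member β ξ η)

      branch-unique : ∀ {β z C} → S β → 𝒞 β C → (C ∩ ↓ γ) ≐ z → branch z β ≐ C
      branch-unique {β} {z} {C} β∈S C∈ C≐z =
        let size≡μ , _ , separates = uniform β β∈S
            ξ , ξ< , ξ≐C = member-covers β C C∈
        in (λ (ζ , ζ<μ , ζ≐z , ζ∋η) → proj₁ (separates (member β ζ) C
               (member-∈ β ζ (subst (ζ <_) (sym size≡μ) ζ<μ)) C∈ (≐-trans ζ≐z (≐-sym C≐z))) ζ∋η) ,
           λ C∋η → ξ , subst (ξ <_) size≡μ ξ< , ≐-trans (∩↓-cong γ ξ≐C) C≐z , proj₂ ξ≐C C∋η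

      record Split (z : Subset) : Set (lsuc ℓ) where
        field
          T₀ T₁        : Subset
          T₀⊆S         : ∀ β → T₀ β → S β
          T₁⊆S         : ∀ β → T₁ β → S β
          T₀-positive  : Positive T₀
          T₁-positive  : Positive T₁
          incompatible : ∀ (C : Subset) {β₀ β₁} → T₀ β₀ → T₁ β₁ → 𝒞 β₀ (C ∩ ↓ β₀) → 𝒞 β₁ (C ∩ ↓ β₁) →
                         ¬ (C ∩ ↓ γ) ≐ z

      module _ (z : Subset) where

        With Without : Ord → Subset
        With ξ β = Trace z β × ξ < β × branch z β ξ
        Without ξ β = Trace z β × ξ < β × ¬ branch z β ξ

        -- If `C` has trace `z` and `C ∩ ↓ β` is in `𝒞 β` for a `β` in `S`, then `β` is in
        -- `Trace z`. So the rest of `S` excludes `z` alone and fills both places.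
        split-nonStationary : NonStationary (Trace z) → Split z
        split-nonStationary ns = record
          { T₀ = R ; T₁ = R ; T₀⊆S = λ _ → proj₁ ; T₁⊆S = λ _ → proj₁
          ; T₀-positive = R-positive ; T₁-positive = R-positive
          ; incompatible = λ C {β} (β∈S , β∉) _ C∈ _ C≐z → β∉ (trace {C = C} β∈S C∈ C≐z)
          }
          where
          R : Subset
          R β = S β × ¬ Trace z β
          cover : ∀ β → S β → Trace z β ⊎ R β
          cover β β∈S with em {P = Trace z β}
          ... | yes β∈ = inj₁ β∈
          ... | no β∉ = inj₂ (β∈S , β∉)
          R-positive : Positive R
          R-positive = [ (λ pos → ⊥-elim (pos ns)) , (λ pos → pos) ]′ (positive-∪ S-positive cover)

        -- The restrictions of a `C` with trace `z` to `β₀` and `β₁` are the branches there, so `ξ`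
        -- would be both in `C` and outside it.
        split-at : ∀ ξ → Positive (With ξ) → Positive (Without ξ) → Split z
        split-at ξ pos₀ pos₁ = record
          { T₀ = With ξ ; T₁ = Without ξ
          ; T₀⊆S = λ _ t → proj₁ (proj₁ t) ; T₁⊆S = λ _ t → proj₁ (proj₁ t)
          ; T₀-positive = pos₀ ; T₁-positive = pos₁
          ; incompatible = λ C {β₀} {β₁} ((β₀∈S , _) , _ , ξ∈) ((β₁∈S , _) , ξ<β₁ , ξ∉) C∈₀ C∈₁ C≐z →
              ξ∉ (proj₂ (unique C β₁ β₁∈S C∈₁ C≐z)
                   (proj₁ (proj₁ (unique C β₀ β₀∈S C∈₀ C≐z) ξ∈) , ξ<β₁))
          }
          where
          unique : ∀ (C : Subset) β → S β → 𝒞 β (C ∩ ↓ β) → (C ∩ ↓ γ) ≐ z → branch z β ≐ (C ∩ ↓ β)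
          unique C β β∈S C∈ C≐z = branch-unique β∈S C∈
            (≐-trans (∩↓-absorb {C = C} (inj₁ (proj₁ (proj₂ (uniform β β∈S))))) C≐z)

        -- If no ξ splits the branches through z, they agree on a stationary set with
        -- the set of those ξ which belong to stationarily many of them.
        unsplit⇒thread : Positive (Trace z) → ¬ (∃[ ξ ] (Positive (With ξ) × Positive (Without ξ))) →
                         ∃ (IsThread 𝒞)
        unsplit⇒thread trace-positive unsplit = D , thread D approximate
          where
          D : Subset
          D ξ = ⌊ Positive (With ξ) ⌋
          Agree : Ord → Ord → Set ℓ
          Agree β ξ = (branch z β ξ → D ξ) × (D ξ → branch z β ξ)
          Bad : Ord → Subset
          Bad ξ β = Trace z β × ξ < β × ¬ Agree β ξ
          Good : Subset
          Good β = Trace z β × (∀ ξ → ξ < β → Agree β ξ)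
          -- If `With ξ` is positive, `ξ` is in `D` and the bad points lie in `Without ξ`,
          -- nonstationary by `unsplit`. Otherwise they lie in `With ξ`.
          bad-nonStationary : ∀ ξ → NonStationary (Bad ξ)
          bad-nonStationary ξ = decide em
            where
            decide : Dec (Positive (With ξ)) → NonStationary (Bad ξ)
            decide (yes pos) = nonStationary-⊆
                  (λ β (t , ξ<β , bad) → t , ξ<β , λ x → bad ((λ _ → ⌊⌋-intro pos) , (λ _ → x)))
                  (byContradiction λ pos′ → unsplit (ξ , pos , pos′))
            decide (no ¬pos) = nonStationary-⊆
                  (λ β (t , ξ<β , bad) → t , ξ<β , byContradiction λ ¬x →
                    bad ((λ x → ⊥-elim (¬x x)) , (λ d → ⊥-elim (¬pos (⌊⌋-elim d)))))
                  (byContradiction ¬pos)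
          cover : ∀ β → Trace z β → Good β ⊎ (β ≤ w ⊎ ∃[ ξ ] (ξ < β × Bad ξ β))
          cover β t with em {P = ∃[ ξ ] (ξ < β × Bad ξ β)}
          ... | yes bad = inj₂ (inj₂ bad)
          ... | no ¬bad = inj₁ (t , λ ξ ξ<β → byContradiction λ disagree →
                  ¬bad (ξ , ξ<β , t , ξ<β , disagree))
          good-positive : Positive Good
          good-positive = [ (λ pos → pos) , (λ pos → ⊥-elim (pos (diagonal-nonStationary Bad w bad-nonStationary))) ]′
            (positive-∪ trace-positive cover)
          approximate : ∀ α → ∃[ β ] (α < β × ∃[ C ] (𝒞 β C × (C ∩ ↓ β) ≐ (D ∩ ↓ β)))
          approximate α =
            let β , ((β∈S , ξ , ξ<μ , ξ≐z) , agree) , α<β = positive⇒inhabited (positive-above α good-positive)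
                C∈ = member-∈ β ξ (subst (ξ <_) (sym (proj₁ (uniform β β∈S))) ξ<μ)
                unique = branch-unique β∈S C∈ ξ≐z
            in β , α<β , member β ξ , C∈ ,
               (λ {η} (x , lt) → proj₁ (agree η lt) (proj₂ unique x) , lt) ,
               (λ {η} (d , lt) → proj₁ unique (proj₂ (agree η lt) d) , lt)

        split : Split z
        split with em {P = NonStationary (Trace z)} | em {P = ∃[ ξ ] (Positive (With ξ) × Positive (Without ξ))}
        ... | yes ns | _ = split-nonStationary ns
        ... | no _ | yes (ξ , pos , pos′) = split-at ξ pos pos′
        ... | no pos | no unsplit = ⊥-elim (unthreaded (unsplit⇒thread pos unsplit))

      -- Ranks of traces and the family that does not reflect.

      rank′ : ∀ z → Dec (∃ (Trace z)) → Ord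
      rank′ z (yes t) = proj₁ (least (Trace z) t)
      rank′ z (no _) = w

      rank : Subset → Ord
      rank z = rank′ z em

      rank-least : ∀ {z} → ∃ (Trace z) → IsLeast (Trace z) (rank z)
      rank-least {z} t = go em
        where
        go : ∀ d → IsLeast (Trace z) (rank′ z d)
        go (yes t) = proj₂ (least (Trace z) t)
        go (no none) = ⊥-elim (none t)

      rank-cong : ∀ {z z′} → z ≐ z′ → ∃ (Trace z) → rank z ≡ rank z′
      rank-cong {z} {z′} z≐z′ (β , t) = ≤-antisym
        (least-≤ _ (rank-least (β , t)) (move (≐-sym z≐z′) (proj₁ (rank-least (β , move z≐z′ t)))))
        (least-≤ _ (rank-least (β , move z≐z′ t)) (move z≐z′ (proj₁ (rank-least (β , t)))))
        where
        move : ∀ {z z′ β} → z ≐ z′ → Trace z β → Trace z′ β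
        move z≐z′ (β∈S , ξ , ξ<μ , eq) = β∈S , ξ , ξ<μ , ≐-trans eq z≐z′

      memberRank : Ord → Segment μ → Ord
      memberRank β (ξ , _) = rank (member β ξ ∩ ↓ γ)

      -- There are fewer than κ ranks at `β`, and cf(β) is at least κ. A rank not below `β`
      -- contributes an arbitrary `o < β`.
      memberRank-bounded : ∀ β → S β →
        ∃[ η ] (η < β × (∀ j → memberRank β j < β → memberRank β j < η))
      memberRank-bounded β β∈S =
        let η , η<β , bound = cf-bounded (S⊆Cf β∈S) μ<κ λ ξ _ → choose ξ em
        in η , η<β , λ (ξ , ξ<μ) lt →
             let ζ , ζ<η , below = bound ξ (⌊⌋-elim ξ<μ) in ≤-<-trans (below lt) ζ<η
        where
        choose : ∀ ξ → Dec (rank (member β ξ ∩ ↓ γ) < β) →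
                 ∃[ η ] (η < β × (rank (member β ξ ∩ ↓ γ) < β → rank (member β ξ ∩ ↓ γ) ≤ η))
        choose ξ (yes lt) = _ , lt , λ _ → inj₂ refl
        choose ξ (no nlt) = let o , o<β = cf-inhabited (S⊆Cf β∈S) in o , o<β , λ lt → ⊥-elim (nlt lt)

      𝒮 : SizeClass κ
      𝒮 = proj₁ (sizeClass w≤κ μ<κ)

      segment-small : SizeClass.Small 𝒮 (Segment μ)
      segment-small = proj₂ (sizeClass w≤κ μ<κ)

      open SizeClass 𝒮
      open Trapping w-omega regular 𝒮 segment-small memberRank S-positive
      open Family (proj₁ (traps memberRank-bounded))

      trapped : ∀ ϱ → (∀ i → Hits (set i) ϱ) → ∃[ i ] value i ≡ ϱ
      trapped = proj₂ (traps memberRank-bounded)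

      splitAt : ∀ i (j : Segment μ) → Split (member (value i) (proj₁ j) ∩ ↓ γ)
      splitAt i j = split (member (value i) (proj₁ j) ∩ ↓ γ)

      -- `S` makes the trace of `C` occur below α, and the trapping sets confine its rank to some
      -- `value i`. That leaves the traces of the `μ` members at `value i`, and both halves of the
      -- split of each are included.
      Indices : Set ℓ
      Indices = Lift ℓ ⊤ ⊎ (Index ⊎ Σ Index λ _ → Σ (Segment μ) λ _ → Lift ℓ ⊤ ⊎ Lift ℓ ⊤)

      indices-small : Small Indices
      indices-small = ⊎-small ⊤-small (⊎-small index-small
        (Σ-small index-small λ _ → Σ-small segment-small λ _ → ⊎-small ⊤-small ⊤-small))

      target : Indices → Subset
      target (inj₁ _) = S
      target (inj₂ (inj₁ i)) = set i
      target (inj₂ (inj₂ (i , j , inj₁ _))) = Split.T₀ (splitAt i j)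
      target (inj₂ (inj₂ (i , j , inj₂ _))) = Split.T₁ (splitAt i j)

      target-⊆ : ∀ k β → target k β → S β
      target-⊆ (inj₁ _) β β∈S = β∈S
      target-⊆ (inj₂ (inj₁ i)) = set-⊆ i
      target-⊆ (inj₂ (inj₂ (i , j , inj₁ _))) = Split.T₀⊆S (splitAt i j)
      target-⊆ (inj₂ (inj₂ (i , j , inj₂ _))) = Split.T₁⊆S (splitAt i j)

      target-positive : ∀ k → Positive (target k)
      target-positive (inj₁ _) = S-positive
      target-positive (inj₂ (inj₁ i)) = positive i
      target-positive (inj₂ (inj₂ (i , j , inj₁ _))) = Split.T₀-positive (splitAt i j)
      target-positive (inj₂ (inj₂ (i , j , inj₂ _))) = Split.T₁-positive (splitAt i j)

      ¬reflects : ∀ α → ¬ (∀ k → ReflectsAt (target k) α)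
      ¬reflects α reflects = Split.incompatible (splitAt i₀ j) C
        (proj₁ (proj₂ meet₀)) (proj₁ (proj₂ meet₁))
        (proj₂ (proj₂ (proj₂ (proj₂ meet₀)))) (proj₂ (proj₂ (proj₂ (proj₂ meet₁))))
        (subst (λ β → (C ∩ ↓ γ) ≐ (member β ξ ∩ ↓ γ)) (sym (proj₂ caught)) (≐-sym ξ≐C))
        where
        C = proj₁ (nonempty α)
        meet : ∀ k δ → δ < α → ∃[ β ] (target k β × δ < β × β < α × 𝒞 β (C ∩ ↓ β))
        meet k = reflection-meets {T = target k} {C = C} (reflects k) (proj₂ (nonempty α))
        traceBelow : ∃[ β ] (β < α × Trace (C ∩ ↓ γ) β)
        traceBelow =
          let (_ , ((f , f<α , _) , _) , w′ , _ , w′<c) , _ = reflects (inj₁ (lift tt))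
              β , β∈S , _ , β<α , C∈ = meet (inj₁ (lift tt)) (f w′) (f<α w′ w′<c)
          in β , β<α , trace {C = C} β∈S C∈ ≐-refl
        inhabited : ∃ (Trace (C ∩ ↓ γ))
        inhabited = proj₁ traceBelow , proj₂ (proj₂ traceBelow)
        ϱ = rank (C ∩ ↓ γ)
        ϱ<α : ϱ < α
        -- The rank is the first point where the trace occurs, and it occurs below α. So the sets
        -- can be met between `ϱ` and α.
        ϱ<α = ≤-<-trans (least-≤ _ (rank-least inhabited) (proj₂ inhabited)) (proj₁ (proj₂ traceBelow))
        hits : ∀ i → Hits (set i) ϱ
        hits i =
          let β , β∈T , ϱ<β , _ , C∈ = meet (inj₂ (inj₁ i)) ϱ ϱ<α
              _ , ξ , ξ<μ , eq = trace {C = C} (set-⊆ i β β∈T) C∈ ≐-refl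
          in β , β∈T , ϱ<β , (ξ , ⌊⌋-intro ξ<μ) , sym (rank-cong (≐-sym eq) inhabited)
        caught : ∃[ i ] value i ≡ ϱ
        caught = trapped ϱ hits
        i₀ = proj₁ caught
        traceϱ : Trace (C ∩ ↓ γ) ϱ
        traceϱ = proj₁ (rank-least inhabited)
        -- The trace occurs at `ϱ` itself, so a member of `𝒞 ϱ` has it, and the index of this member
        -- selects the split.
        ξ = proj₁ (proj₂ traceϱ)
        ξ≐C : (member ϱ ξ ∩ ↓ γ) ≐ (C ∩ ↓ γ)
        ξ≐C = proj₂ (proj₂ (proj₂ traceϱ))
        j : Segment μ
        j = ξ , ⌊⌋-intro (proj₁ (proj₂ (proj₂ traceϱ)))
        meet₀ = meet (inj₂ (inj₂ (i₀ , j , inj₁ (lift tt)))) ϱ ϱ<α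
        meet₁ = meet (inj₂ (inj₂ (i₀ , j , inj₂ (lift tt)))) ϱ ϱ<α

      ¬refl : ∀ {S′ : Subset} → S ⊆ S′ → ¬ Refl κ S′
      ¬refl S⊆S′ refl′ =
        let δ , δ<κ , emb = embeds indices-small
            α , reflects = refl′ (Range target)
              (λ X≐Y (lift (k , X≐T)) → lift (k , ≐-trans (≐-sym X≐Y) X≐T))
              (range-fewerThan target δ<κ emb)
              λ X (lift (k , X≐T)) →
                (λ X∋β → S⊆S′ (target-⊆ k _ (proj₁ X≐T X∋β))) ,
                positive⇒stationary (positive-⊆ (λ _ → proj₂ X≐T) (target-positive k))
        in ¬reflects α λ k → reflects (target k) (lift (k , ≐-refl))

    ¬refl-positive : ¬ ∃ (IsThread 𝒞) → ∀ {S} → Positive S → S ⊆ Cf≥ κ → ¬ Refl κ S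
    ¬refl-positive unthreaded {S} S-positive S⊆Cf =
      -- `size β` is below κ, hence regressive beyond κ.
      let μ , S₁-positive = fodor (λ μ β → S β × size β ≡ μ) κ S-positive
            λ β β∈S κ<β → size β , <-trans (size<κ β) κ<β , β∈S , refl
          -- `Separates` quantifies over subsets and is resized to define a `Subset`.
          γ , S₂-positive = fodor (λ γ β → (S β × size β ≡ μ) × γ < β × ⌊ Separates γ β ⌋) w S₁-positive
            λ β (β∈S , size≡μ) _ → let γ , γ<β , sep = separated β (S⊆Cf β∈S)
                                   in γ , γ<β , (β∈S , size≡μ) , γ<β , ⌊⌋-intro sep
          β₀ , _ , size≡μ = positive⇒inhabited S₁-positive
      in Uniform.¬refl unthreaded (λ ((β∈S , _) , _) → S⊆Cf β∈S)
           (subst (_< κ) size≡μ (size<κ β₀))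
           (λ β ((_ , eq) , γ<β , sep) → eq , γ<β , ⌊⌋-elim sep) S₂-positive
           (λ ((β∈S , _) , _) → β∈S)

theorem2p9 : ∀ {ℓ} → (∀ {a} → ExcludedMiddle a) →
    (Λ : Ordinal ℓ) → let open Below Λ in
    LengthIsRegular →
    (κ : Ord) → IsInfiniteCardinal κ →
    Square κ →
    (S : Subset) → IsStationary S → S ⊆ Cf≥ κ →
    ¬ Refl κ S
theorem2p9 em Λ regular κ (_ , w , w-omega , w≤κ) (𝒞 , coherence , unthreaded) S stationary =
  ¬refl-positive unthreaded (stationary⇒positive stationary)
  where
  open Proof em Λ
  open Stationarity w-omega regular using (stationary⇒positive)
  open CoherentSequence w-omega regular w≤κ coherence using (¬refl-positive)
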